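{- Let $G$ be any edge-weighted graph of treewidth $t$ with $n$ vertices, and let $\varepsilon\in(0,1)$. Then there is a $(1+\varepsilon)$-tree cover for the shortest-path metric of $G$ consisting of $2^{(t/\varepsilon)^{O(t)}}$ trees.
   Context: An edge-weighted tree $T$ with shortest-path distance $d_T$ is a dominating tree of a metric space $(X,\delta_X)$ if $X\subseteq V(T)$ and $\delta_X(x,y)\le d_T(x,y)$ for all $x,y\in X$. For $\alpha\ge 1$, an $\alpha$-tree cover of $(X,\delta_X)$ is a collection of dominating trees such that for every $x\neq y$ in $X$ some tree $T$ in the collection satisfies $d_T(x,y)\le \alpha\,\delta_X(x,y)$. Its size is the number of trees.
   Formalization: The edge weights of the graph G and the parameter ε in (0,1) are taken to be rational numbers instead of real numbers. -}

module Defs where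

open import Data.Nat as ℕ using (ℕ; suc)
open import Data.Fin using (Fin)
open import Data.List using (List; []; _∷_; length; lookup)
open import Data.List.Membership.Propositional using (_∈_)
open import Data.List.Relation.Unary.All using (All)
open import Data.List.Relation.Unary.Unique.Propositional using (Unique)
open import Data.Product using (Σ; ∃; _×_; _,_; proj₁; proj₂)
open import Data.Sum using (_⊎_)
open import Data.Rational using (ℚ; 0ℚ; 1ℚ; _+_; _*_; _≤_; _<_)
open import Function.Definitions using (Injective)
open import Relation.Binary.PropositionalEquality using (_≡_; _≢_)
open import Relation.Nullary using (¬_)

module _ {n : ℕ} {A : Set} (ends : A → Fin n × Fin n) (E : List A) where

  Joins : Fin (length E) → Fin n → Fin n → Set
  Joins i u w = (proj₁ (ends (lookup E i)) ≡ u × proj₂ (ends (lookup E i)) ≡ w)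
              ⊎ (proj₁ (ends (lookup E i)) ≡ w × proj₂ (ends (lookup E i)) ≡ u)

  data Walk : Fin n → Fin n → Set where
    nil  : ∀ {v} → Walk v v
    cons : ∀ {u w x} (i : Fin (length E)) → Joins i u w → Walk w x → Walk u x

  edgesOf : ∀ {u v} → Walk u v → List (Fin (length E))
  edgesOf nil = []
  edgesOf (cons i _ p) = i ∷ edgesOf p

  vertsOf : ∀ {u v} → Walk u v → List (Fin n)
  vertsOf {u} nil = u ∷ []
  vertsOf {u} (cons _ _ p) = u ∷ vertsOf p

  Connected : Set
  Connected = ∀ x y → Walk x y

  Acyclic : Set
  Acyclic = ∀ v (p : Walk v v) → Unique (edgesOf p) → edgesOf p ≡ []

  IsTree : Set
  IsTree = Connected × Acyclic

WEdge : ℕ → Set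
WEdge n = Fin n × Fin n × ℚ

wends : ∀ {n} → WEdge n → Fin n × Fin n
wends (u , w , _) = (u , w)

weight : ∀ {n} → WEdge n → ℚ
weight (_ , _ , c) = c

WGraph : ℕ → Set
WGraph n = List (WEdge n)

WWalk : ∀ {n} → WGraph n → Fin n → Fin n → Set
WWalk G = Walk wends G

len : ∀ {n} (G : WGraph n) {u v} → WWalk G u v → ℚ
len G nil = 0ℚ
len G (cons i _ p) = weight (lookup G i) + len G p

IsDist : ∀ {n} (G : WGraph n) → Fin n → Fin n → ℚ → Set
IsDist G x y d = (Σ (WWalk G x y) λ p → len G p ≡ d)
               × (∀ (p : WWalk G x y) → d ≤ len G p)

record TreeDecomposition {n : ℕ} (G : WGraph n) (t : ℕ) : Set where
  field
    k      : ℕ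
    tedges : List (Fin (suc k) × Fin (suc k))
    isTree : IsTree (λ e → e) tedges
    bag    : Fin (suc k) → List (Fin n)
    bagUnique  : ∀ b → Unique (bag b)
    bagWidth   : ∀ b → length (bag b) ℕ.≤ suc t
    vertexCov  : ∀ (v : Fin n) → ∃ λ b → v ∈ bag b
    edgeCov    : ∀ (i : Fin (length G)) → ∃ λ b →
                   proj₁ (wends (lookup G i)) ∈ bag b × proj₂ (wends (lookup G i)) ∈ bag b
    coherent   : ∀ (v : Fin n) b₁ b₂ → v ∈ bag b₁ → v ∈ bag b₂ →
                   Σ (Walk (λ e → e) tedges b₁ b₂) λ p →
                     All (λ b → v ∈ bag b) (vertsOf (λ e → e) tedges p)

TreewidthAtMost : ∀ {n} → WGraph n → ℕ → Set
TreewidthAtMost G t = TreeDecomposition G t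

PositiveWeights : ∀ {n} → WGraph n → Set
PositiveWeights G = All (λ e → 0ℚ < weight e) G

record DominatingTree {n : ℕ} (G : WGraph n) : Set where
  field
    m       : ℕ
    T       : WGraph (suc m)
    isTree  : IsTree wends T
    nonneg  : All (λ e → 0ℚ ≤ weight e) T
    emb     : Fin n → Fin (suc m)
    embInj  : Injective _≡_ _≡_ emb
    dominating : ∀ x y dG dT → IsDist G x y dG → IsDist T (emb x) (emb y) dT → dG ≤ dT

open DominatingTree public

IsTreeCover : ∀ {n} (G : WGraph n) (ε : ℚ) → List (DominatingTree G) → Set
IsTreeCover G ε cover =
  ∀ x y → x ≢ y → Σ (DominatingTree G) λ D → D ∈ cover ×
    (∀ dG dT → IsDist G x y dG → IsDist (T D) (emb D x) (emb D y) dT →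
       dT ≤ (1ℚ + ε) * dG)

{-# OPTIONS --safe #-}

-- Idea. Scale the weights to integers and root the tree decomposition. At a scale R each bag carries at
-- most t + 1 labels, a label being an earlier bag within R of a vertex of the current one. Along a path of
-- length R, two hops from a label to the labels just above it already climb past every bag met (`jump`), so
-- points x, y at distance O(R/ε²) have a common label near a shortest path between them among the boundedly
-- many labels reachable in O(1/ε²) hops. Colour the labels top-down so that labels reachable from one
-- another differ; then labels of one colour serve disjoint regions, and linking every vertex to a bag vertex
-- of the label serving it is a star forest with additive error O(R). Stacking these forests over
-- geometrically growing scales gives trees with Steiner points, and the number of colours and bag positions
-- bounds the number of trees. In width at most one a single tree is exact; this case is separate because
-- there the exponent (t/ε)^(ct) may be arbitrarily close to 1.

module Submission where

open import Defs hiding (m; T; isTree; nonneg; emb; embInj; dominating)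
open import Data.Nat using (ℕ; zero; suc)

-- The size bound must not depend on the number of scales. One tree therefore uses the same colour
-- and the same bag position at every scale: a pair of points needs only one scale at which that
-- choice fits, and at all the others it is enough that links are short. The price is that a point
-- arrives at its scale already displaced by the links below. Hence labels are built with `R` equal
-- to `φ + φ`, a label serves everything within φ of a vertex entitled to it, and links are cut off
-- at `linkBound`, which keeps the total displacement at most the next φ. Domination is automatic,
-- because a tree edge carries the distance between the vertices that its ends represent; only the
-- stretch needs an argument. Lengths are integers throughout, and the precision enters as an
-- integer `K` with Kε ≥ 1.

module TreeCovers where

  open import Data.Nat
  open import Data.Nat.Properties
  open import Data.Nat.DivMod using (m%n<n; m≡m%n+[m/n]*n; m/n*n≤m)
  open import Data.Nat.Tactic.RingSolver using (solve-∀)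
  open import Data.Integer as ℤ using (-[1+_]; ∣_∣; +<+; +≤+)
  import Data.Integer.Properties as ℤ
  open import Data.Rational as ℚ using (ℚ; 0ℚ; 1ℚ; mkℚ; *<*; ↥_; ↧ₙ_)
  import Data.Rational.Properties as ℚ
  open import Data.Rational.Unnormalised as ℚᵘ using (mkℚᵘ; _≃_; *≡*)
  import Data.Rational.Unnormalised.Properties as ℚᵘ
  open import Data.Fin using (Fin; toℕ; zero; suc; fromℕ<; combine; remQuot)
  open import Data.Fin.Properties as Finₚ using (any?; pigeonhole; toℕ<n; toℕ-injective; toℕ-fromℕ<; remQuot-combine; combine-injectiveʳ) renaming (_≟_ to _≟ᶠ_)
  open import Data.List using (List; []; _∷_; length; lookup; map; filter; concatMap; tabulate; _++_)
  open import Data.List.Properties using (length-map; length-++; length-tabulate)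
  import Data.List.Extrema ≤-totalOrder as Ext
  open import Data.List.Membership.Propositional using (_∈_; find; lose)
  open import Data.List.Membership.Propositional.Properties
  open import Data.List.Membership.DecPropositional using () renaming (_∈?_ to memb?)
  open import Data.List.Relation.Unary.Any as Any using (Any; here; there)
  import Data.List.Relation.Unary.Any.Properties as Anyₚ
  open import Data.List.Relation.Unary.All as All using (All; []; _∷_)
  import Data.List.Relation.Unary.All.Properties as Allₚ
  open import Data.List.Relation.Unary.AllPairs using ([]; _∷_)
  open import Data.List.Relation.Unary.Unique.Propositional using (Unique)
  import Data.List.Relation.Unary.Unique.Propositional.Properties as Uniqueₚ
  open import Data.Product using (Σ; ∃; ∃₂; _×_; _,_; proj₁; proj₂)
  open import Data.Sum using (_⊎_; inj₁; inj₂; [_,_]′; swap)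
  open import Data.Empty using (⊥-elim)
  open import Function using (_∘_; id)
  open import Relation.Nullary
  open import Relation.Nullary.Decidable using (decidable-stable)
  open import Relation.Binary.PropositionalEquality hiding (J)

  -- Integer metrics and rooted decompositions

  record Metric (n : ℕ) : Set where
    field
      δ     : Fin n → Fin n → ℕ
      δ-self : ∀ u → δ u u ≡ 0
      δ-sym  : ∀ u v → δ u v ≡ δ v u
      δ-tri  : ∀ u v w → δ u w ≤ δ u v + δ v w

  module _ {A : Set} (f : A → A) where
    iter : ℕ → A → A
    iter zero a = a
    iter (suc j) a = iter j (f a)

    iter-+ : ∀ i j a → iter (i + j) a ≡ iter j (iter i a)
    iter-+ zero j a = refl
    iter-+ (suc i) j a = iter-+ i j (f a)

  -- The depth laws force the root to be its own parent, so `par` can be iterated freely. `b ⊑ c`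
  -- makes `c` an ancestor of `b` or `b` itself: the order grows towards the root, where `dep` is
  -- smallest.
  record RootedNodes : Set where
    field
      k        : ℕ
      root     : Fin (suc k)
      par      : Fin (suc k) → Fin (suc k)
      dep      : Fin (suc k) → ℕ
      dep-par  : ∀ b → dep (par b) ≡ pred (dep b)
      root-dep : dep root ≡ 0
      dep-root : ∀ b → dep b ≡ 0 → b ≡ root

    Node : Set
    Node = Fin (suc k)

    infix 4 _⊑_
    _⊑_ : Node → Node → Set
    b ⊑ c = ∃ λ j → iter par j b ≡ c

    module Ancestors where
      ⊑-refl : ∀ {b} → b ⊑ b
      ⊑-refl = 0 , refl

      ⊑-trans : ∀ {b c d} → b ⊑ c → c ⊑ d → b ⊑ d
      ⊑-trans {b} (i , refl) (j , refl) = i + j , iter-+ par i j b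

      ⊑-par : ∀ {b} → b ⊑ par b
      ⊑-par = 1 , refl

      ⊑-uncons : ∀ {b c} → b ⊑ c → b ≡ c ⊎ par b ⊑ c
      ⊑-uncons (zero , refl) = inj₁ refl
      ⊑-uncons (suc j , p) = inj₂ (j , p)

      ⊑-linear : ∀ {b c d} → b ⊑ c → b ⊑ d → c ⊑ d ⊎ d ⊑ c
      ⊑-linear (zero , refl) b⊑d = inj₁ b⊑d
      ⊑-linear (suc i , p) (zero , refl) = inj₂ (suc i , p)
      ⊑-linear (suc i , p) (suc j , q) = ⊑-linear (i , p) (j , q)

      dep-mono : ∀ {b c} → b ⊑ c → dep c ≤ dep b
      dep-mono (zero , refl) = ≤-refl
      dep-mono {b} (suc j , p) =
        ≤-trans (dep-mono (j , p)) (≤-trans (≤-reflexive (dep-par b)) pred[n]≤n)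

      ⊑-dep≡ : ∀ {b c} → b ⊑ c → dep b ≤ dep c → b ≡ c
      ⊑-dep≡ {b} {c} b⊑c db≤dc with ⊑-uncons b⊑c
      ... | inj₁ b≡c = b≡c
      ... | inj₂ pb⊑c with dep b in eq
      ...   | zero = trans (dep-root b eq) (sym (dep-root c (n≤0⇒n≡0 dc≤0)))
        where
        dc≤0 : dep c ≤ 0
        dc≤0 = ≤-trans (dep-mono pb⊑c) (≤-reflexive (trans (dep-par b) (cong pred eq)))
      ...   | suc d = ⊥-elim (<⇒≱ db≤dc
                (≤-trans (dep-mono pb⊑c) (≤-reflexive (trans (dep-par b) (cong pred eq)))))

      ⊑-antisym : ∀ {b c} → b ⊑ c → c ⊑ b → b ≡ c
      ⊑-antisym b⊑c c⊑b = ⊑-dep≡ b⊑c (dep-mono c⊑b)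

      dep-strict : ∀ {b c} → b ⊑ c → b ≢ c → dep c < dep b
      dep-strict b⊑c b≢c = ≰⇒> λ le → b≢c (⊑-dep≡ b⊑c le)

      ⊑-of-dep : ∀ {b c d} → b ⊑ c → b ⊑ d → dep d ≤ dep c → c ⊑ d
      ⊑-of-dep b⊑c b⊑d le with ⊑-linear b⊑c b⊑d
      ... | inj₁ c⊑d = c⊑d
      ... | inj₂ d⊑c rewrite ⊑-dep≡ d⊑c le = ⊑-refl

      ⊑-root : ∀ b → b ⊑ root
      ⊑-root b = go (dep b) b refl
        where
        go : ∀ d b → dep b ≡ d → b ⊑ root
        go zero b e rewrite dep-root b e = ⊑-refl
        go (suc d) b e = ⊑-trans ⊑-par (go d (par b) (trans (dep-par b) (cong pred e)))

      root-⊑ : ∀ {c} → root ⊑ c → root ≡ c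
      root-⊑ r⊑c = ⊑-dep≡ r⊑c (≤-trans (≤-reflexive root-dep) z≤n)

      _⊑?_ : ∀ b c → Dec (b ⊑ c)
      b ⊑? c = go (dep b) b refl
        where
        go : ∀ d b → dep b ≡ d → Dec (b ⊑ c)
        go d b e with b ≟ᶠ c
        go d b e | yes refl = yes ⊑-refl
        go zero b e | no b≢c =
          no λ b⊑c → b≢c (⊑-dep≡ b⊑c (≤-trans (≤-reflexive e) z≤n))
        go (suc d) b e | no b≢c with go d (par b) (trans (dep-par b) (cong pred e))
        ... | yes pb⊑c = yes (⊑-trans ⊑-par pb⊑c)
        ... | no pb⋢c = no λ b⊑c → [ b≢c , pb⋢c ]′ (⊑-uncons b⊑c)

      depth? : ∀ b → b ≡ root ⊎ 0 < dep b
      depth? b with dep b in eq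
      ... | zero = inj₁ (dep-root b eq)
      ... | suc _ = inj₂ z<s

      dep-par< : ∀ {b} → 0 < dep b → dep (par b) < dep b
      dep-par< {b} 0<d = ≤-trans (s≤s (≤-reflexive (dep-par b)))
                           (≤-reflexive (suc-pred (dep b) {{>-nonZero 0<d}}))

  -- `sep` is all that remains of the graph: a shortest path leaving the subtree below `c` passes
  -- through a vertex common to the bags of `c` and `par c`.
  record RootedDecomposition {n : ℕ} (X : Metric n) (t : ℕ) : Set where
    open Metric X
    field
      nodes    : RootedNodes
    open RootedNodes nodes public
    open Ancestors public
    field
      bag      : Node → List (Fin n)
      bagWidth : ∀ b → length (bag b) ≤ suc t
      home     : Fin n → Node
      home∈    : ∀ v → v ∈ bag (home v)
      sep      : ∀ {b b' c u v} → b ⊑ c → ¬ (b' ⊑ c) → u ∈ bag b → v ∈ bag b' →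
                 ∃ λ m → m ∈ bag c × m ∈ bag (par c) × δ u m + δ m v ≤ δ u v

    crossing : ∀ {b c e u w} → b ⊑ c → c ⊑ e → u ∈ bag b → w ∈ bag e →
               ∃ λ m → m ∈ bag c × δ u m + δ m w ≤ δ u w
    crossing {b} {c} {e} {u} {w} b⊑c c⊑e u∈ w∈ with c ≟ᶠ e
    ... | yes refl = w , w∈ , ≤-reflexive (trans (cong (δ u w +_) (δ-self w)) (+-identityʳ _))
    ... | no c≢e with sep b⊑c (λ e⊑c → c≢e (⊑-antisym c⊑e e⊑c)) u∈ w∈
    ...   | m , m∈ , _ , le = m , m∈ , le

  -- Labels and hops at a single scale R

  -- A label is a node C, standing for all vertices of its bag. Going down the tree, each vertex of a bag
  -- keeps the oldest (highest) label of the parent bag that is within R of it, and takes the bag itself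
  -- as a new label if there is none. So a bag carries at most t + 1 labels.
  module Labels {n t} {X : Metric n} (D : RootedDecomposition X t) (R : ℕ) where
    open Metric X
    open RootedDecomposition D

    Near : Fin n → Node → Set
    Near q C = Any (λ m → δ q m ≤ R) (bag C)

    near? : ∀ q C → Dec (Near q C)
    near? q C = Any.any? (λ m → δ q m ≤? R) (bag C)

    -- `b` is the default of the minimum and also competes in it. Labels of the parent bag lie
    -- strictly higher, so `b` wins only if none of them is near `q`.
    oldest : Node → List Node → Fin n → Node
    oldest b L q = Ext.argmin dep b (filter (near? q) L)

    labelsTo : ℕ → Node → List Node
    labelsTo zero b = b ∷ []
    labelsTo (suc d) b = map (oldest b (labelsTo d (par b))) (bag b)

    labels : Node → List Node
    labels b = labelsTo (dep b) b

    labels-step : ∀ b → 0 < dep b → labels b ≡ map (oldest b (labels (par b))) (bag b)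
    labels-step b 0<d with dep b in eq
    ... | suc d rewrite trans (dep-par b) (cong pred eq) = refl

    labels-root : labels root ≡ root ∷ []
    labels-root rewrite root-dep = refl

    labels-length : ∀ b → length (labels b) ≤ suc t
    labels-length b with dep b
    ... | zero = s≤s z≤n
    ... | suc d = ≤-trans (≤-reflexive (length-map _ (bag b))) (bagWidth b)

    labels-inherit : ∀ {b C} → C ∈ labels b → C ≡ b ⊎ C ∈ labels (par b)
    labels-inherit {b} C∈ with depth? b
    labels-inherit {b} C∈ | inj₁ refl rewrite labels-root with C∈
    ... | here C≡ = inj₁ C≡
    labels-inherit {b} {C} C∈ | inj₂ 0<d
      with ∈-map⁻ (oldest b (labels (par b))) (subst (C ∈_) (labels-step b 0<d) C∈)
    ... | q , _ , refl with Ext.argmin-sel dep b (filter (near? q) (labels (par b)))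
    ...   | inj₁ e = inj₁ e
    ...   | inj₂ i = inj₂ (proj₁ (∈-filter⁻ (near? q) i))

    labels-oldest : ∀ {b q} → q ∈ bag b →
      ∃ λ C → C ∈ labels b × Near q C × (∀ {F} → F ∈ labels (par b) → Near q F → dep C ≤ dep F)
    labels-oldest {b} {q} q∈ with depth? b
    ... | inj₁ refl = root , subst (root ∈_) (sym labels-root) (here refl)
          , lose q∈ (≤-trans (≤-reflexive (δ-self q)) z≤n)
          , λ _ _ → ≤-trans (≤-reflexive root-dep) z≤n
    ... | inj₂ 0<d = C , subst (C ∈_) (sym (labels-step b 0<d)) (∈-map⁺ _ q∈) , nearC , minC
      where
      L = filter (near? q) (labels (par b))
      C = Ext.argmin dep b L
      nearC : Near q C
      nearC with Ext.argmin-sel dep b L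
      ... | inj₁ e = subst (Near q) (sym e) (lose q∈ (≤-trans (≤-reflexive (δ-self q)) z≤n))
      ... | inj₂ i = proj₂ (∈-filter⁻ (near? q) {xs = labels (par b)} i)
      minC : ∀ {F} → F ∈ labels (par b) → Near q F → dep C ≤ dep F
      minC F∈ nF = All.lookup (Ext.f[argmin]≤f[xs] {f = dep} b L) (∈-filter⁺ (near? q) F∈ nF)

    labels-above : ∀ {b C} → C ∈ labels b → b ⊑ C
    labels-above {b} C∈ = go (dep b) b refl C∈
      where
      go : ∀ d b {C} → dep b ≡ d → C ∈ labels b → b ⊑ C
      go zero b e C∈ rewrite dep-root b e with subst (_ ∈_) labels-root C∈
      ... | here refl = ⊑-refl
      go (suc d) b e C∈ with labels-inherit C∈
      ... | inj₁ refl = ⊑-refl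
      ... | inj₂ C∈' = ⊑-trans ⊑-par (go d (par b) (trans (dep-par b) (cong pred e)) C∈')

    -- A label is created only at its own node and otherwise inherited from the parent bag, so no
    -- bag in between can miss it.
    labels-contiguous : ∀ {b c C} → C ∈ labels b → b ⊑ c → c ⊑ C → C ∈ labels c
    labels-contiguous C∈ (j , p) c⊑C = go j p C∈ c⊑C
      where
      go : ∀ j {b c C} → iter par j b ≡ c → C ∈ labels b → c ⊑ C → C ∈ labels c
      go zero refl C∈ c⊑C = C∈
      go (suc j) p C∈ c⊑C with labels-inherit C∈
      ... | inj₁ refl = subst (λ z → _ ∈ labels z) (⊑-antisym (suc j , p) c⊑C) C∈
      ... | inj₂ C∈' = go j p C∈' c⊑C

    -- After a label `C` the search resumes at `par C`, where `C` is no longer on offer, so hops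
    -- climb strictly until they meet the root. `reach zero` already holds one layer of labels; this
    -- is why joining two searches costs an extra hop in `reach-trans`.
    reach : ℕ → Node → List Node
    reach zero b = labels b
    reach (suc h) b = labels b ++ concatMap (λ C → reach h (par C)) (labels b)

    reach-label : ∀ h {b C} → C ∈ labels b → C ∈ reach h b
    reach-label zero C∈ = C∈
    reach-label (suc h) C∈ = ∈-++⁺ˡ C∈

    reach-hop : ∀ h {b C E} → C ∈ labels b → E ∈ reach h (par C) → E ∈ reach (suc h) b
    reach-hop h {b} C∈ E∈ = ∈-++⁺ʳ (labels b) (∈-concatMap⁺ (λ C → reach h (par C)) (lose C∈ E∈))

    reach-cases : ∀ h {b E} → E ∈ reach (suc h) b →
                  E ∈ labels b ⊎ ∃ λ C → C ∈ labels b × E ∈ reach h (par C)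
    reach-cases h {b} E∈ with ∈-++⁻ (labels b) E∈
    ... | inj₁ E∈ℓ = inj₁ E∈ℓ
    ... | inj₂ E∈c = inj₂ (find (∈-concatMap⁻ (λ C → reach h (par C)) E∈c))

    reach-mono : ∀ {h h'} → h ≤ h' → ∀ {b E} → E ∈ reach h b → E ∈ reach h' b
    reach-mono {h' = h'} z≤n E∈ = reach-label h' E∈
    reach-mono {suc h} {suc h'} (s≤s le) E∈ with reach-cases h E∈
    ... | inj₁ E∈ℓ = reach-label (suc h') E∈ℓ
    ... | inj₂ (C , C∈ , E∈') = reach-hop h' C∈ (reach-mono le E∈')

    reach-trans : ∀ h h' {b C E} → C ∈ reach h b → E ∈ reach h' (par C) → E ∈ reach (suc h + h') b
    reach-trans zero h' C∈ E∈ = reach-hop h' C∈ E∈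
    reach-trans (suc h) h' C∈ E∈ with reach-cases h C∈
    ... | inj₁ C∈ℓ = reach-mono (s≤s (m≤n+m h' (suc h))) (reach-hop h' C∈ℓ E∈)
    ... | inj₂ (B , B∈ , C∈') = reach-hop (suc h + h') B∈ (reach-trans h h' C∈' E∈)

    reach-above : ∀ h {b E} → E ∈ reach h b → b ⊑ E
    reach-above zero E∈ = labels-above E∈
    reach-above (suc h) E∈ with reach-cases h E∈
    ... | inj₁ E∈ℓ = labels-above E∈ℓ
    ... | inj₂ (C , C∈ , E∈') = ⊑-trans (labels-above C∈) (⊑-trans ⊑-par (reach-above h E∈'))

    -- Hops landing strictly below `c` are dropped. The first label at or above `c` was chosen from
    -- a node not above `c`, so contiguity makes it a label of `c` itself, and the rest of the
    -- search is unchanged. This lets searches from different points be compared.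
    reach-cross : ∀ h {b c E} → E ∈ reach h b → b ⊑ c → c ⊑ E → E ∈ reach h c
    reach-cross zero E∈ b⊑c c⊑E = labels-contiguous E∈ b⊑c c⊑E
    reach-cross (suc h) {b} {c} E∈ b⊑c c⊑E with reach-cases h E∈
    ... | inj₁ E∈ℓ = reach-label (suc h) (labels-contiguous E∈ℓ b⊑c c⊑E)
    ... | inj₂ (C , C∈ , E∈') with c ⊑? C
    ...   | yes c⊑C = reach-hop h (labels-contiguous C∈ b⊑c c⊑C) E∈'
    ...   | no c⋢C with ⊑-linear b⊑c (labels-above C∈)
    ...     | inj₁ c⊑C = ⊥-elim (c⋢C c⊑C)
    ...     | inj₂ C⊑c with ⊑-uncons C⊑c
    ...       | inj₁ refl = ⊥-elim (c⋢C ⊑-refl)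
    ...       | inj₂ pC⊑c = reach-mono (n≤1+n h) (reach-cross h E∈' pC⊑c c⊑E)

    -- The extra one makes the count geometric, each label paying for itself and for the search it
    -- starts; later it is the spare colour of the greedy colouring.
    reach-length : ∀ h b → suc (length (reach h b)) ≤ (2 + t) ^ suc h
    reach-length zero b = ≤-trans (s≤s (labels-length b)) (≤-reflexive (sym (*-identityʳ (2 + t))))
    reach-length (suc h) b = begin
      suc (length (reach (suc h) b))
        ≡⟨ cong suc (length-++ (labels b)) ⟩
      suc (length (labels b) + length (concatMap (λ C → reach h (par C)) (labels b)))
        ≤⟨ s≤s (go (labels b)) ⟩
      suc (length (labels b) * (2 + t) ^ suc h)
        ≤⟨ s≤s (*-monoˡ-≤ ((2 + t) ^ suc h) (labels-length b)) ⟩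
      1 + suc t * (2 + t) ^ suc h
        ≤⟨ +-monoˡ-≤ _ (m^n>0 (2 + t) (suc h)) ⟩
      (2 + t) ^ suc (suc h) ∎
      where
      open ≤-Reasoning
      go : ∀ L → length L + length (concatMap (λ C → reach h (par C)) L) ≤ length L * (2 + t) ^ suc h
      go [] = z≤n
      go (C ∷ L) = begin
        suc (length L + length (reach h (par C) ++ rest))
          ≡⟨ cong (λ z → suc (length L + z)) (length-++ (reach h (par C))) ⟩
        suc (length L + (length (reach h (par C)) + length rest))
          ≡⟨ cong suc (x∙yz≈y∙xz (length L) (length (reach h (par C))) (length rest)) ⟩
        suc (length (reach h (par C))) + (length L + length rest)
          ≤⟨ +-mono-≤ (reach-length h (par C)) (go L) ⟩
        (2 + t) ^ suc h + length L * (2 + t) ^ suc h ∎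
        where
        rest = concatMap (λ C → reach h (par C)) L
        open import Algebra.Properties.CommutativeSemigroup +-commutativeSemigroup using (x∙yz≈y∙xz)

    Landing : Node → Node → Fin n → Set
    Landing b ω g = ∃ λ E → E ∈ reach 1 b × ω ⊑ E × ∃ λ m → m ∈ bag E × δ g m ≤ R + R

    -- If C is the label of g and F is an older label alive just above C, then F was dropped at some
    -- node between C and g because a still older label was near the path from g to g'.
    jump : ∀ {b ω g g'} → b ⊑ ω → g ∈ bag b → g' ∈ bag ω → δ g g' ≤ R →
           Landing b ω g
    jump {b} {ω} {g} {g'} b⊑ω g∈ g'∈ gg'≤R with labels-oldest g∈
    ... | C , C∈ , nearC , oldestC with ω ⊑? C
    ...   | yes ω⊑C = C , reach-label 1 C∈ , ω⊑C
                    , let m , m∈ , le = find nearC in m , m∈ , ≤-trans le (m≤m+n R R)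
    ...   | no ω⋢C = start
      where
      b⊑C = labels-above C∈

      pC⊑ω : par C ⊑ ω
      pC⊑ω with ⊑-linear b⊑C b⊑ω
      ... | inj₂ ω⊑C = ⊥-elim (ω⋢C ω⊑C)
      ... | inj₁ C⊑ω with ⊑-uncons C⊑ω
      ...   | inj₁ refl = ⊥-elim (ω⋢C ⊑-refl)
      ...   | inj₂ p = p

      on-path : ∀ {c} → b ⊑ c → c ⊑ ω → ∃ λ u → u ∈ bag c × δ g u ≤ R × δ u g' ≤ R
      on-path b⊑c c⊑ω with crossing b⊑c c⊑ω g∈ g'∈
      ... | u , u∈ , le = u , u∈ , ≤-trans (m≤m+n _ _) (≤-trans le gg'≤R)
                        , ≤-trans (m≤n+m _ _) (≤-trans le gg'≤R)

      near-path : ∀ {c F u} → u ∈ bag c → δ u g' ≤ R → c ⊑ F → F ⊑ ω → Near u F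
      near-path u∈ ug'≤R c⊑F F⊑ω with crossing c⊑F F⊑ω u∈ g'∈
      ... | m , m∈ , le = lose m∈ (≤-trans (m≤m+n _ _) (≤-trans le ug'≤R))

      C≢root : 0 < dep C
      C≢root with depth? C
      ... | inj₂ 0<d = 0<d
      ... | inj₁ refl = ⊥-elim (ω⋢C (subst (ω ⊑_) refl (⊑-root ω)))

      dep-pC : dep (par C) < dep C
      dep-pC = dep-par< C≢root

      dropped : ∀ j c {F} → iter par j c ≡ C → b ⊑ c → F ∈ labels (par C) → ¬ (F ∈ labels (par b)) →
                ¬ (F ∈ labels c) →
                ∃ λ c → b ⊑ c × c ⊑ C × F ∈ labels (par c) × ¬ (F ∈ labels c)
      dropped j c {F} e b⊑c F∈ F∉ F∉c with memb? _≟ᶠ_ F (labels (par c))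
      ... | yes F∈pc = c , b⊑c , (j , e) , F∈pc , F∉c
      dropped zero c refl b⊑c F∈ F∉ F∉c | no F∉pc = ⊥-elim (F∉pc F∈)
      dropped (suc j) c e b⊑c F∈ F∉ F∉c | no F∉pc =
        dropped j (par c) e (⊑-trans b⊑c ⊑-par) F∈ F∉ F∉pc

      -- `d` bounds the depth of `F`. If `F` is too low, a strictly older label of `par C` replaces
      -- it; the distance to `g` is measured afresh through a vertex of the path, so `R + R` does
      -- not accumulate.
      chase : ∀ d {F} → dep F ≤ d → F ∈ labels (par C) →
              (∃ λ m → m ∈ bag F × δ g m ≤ R + R) → Landing b ω g
      chase d {F} dF≤d F∈ nearF with ω ⊑? F
      ... | yes ω⊑F = F , reach-hop 0 C∈ F∈ , ω⊑F , nearF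
      ... | no ω⋢F = older d dF≤d
        where
        pC⊑F = labels-above F∈
        C⊑F = ⊑-trans ⊑-par pC⊑F
        b⊑F = ⊑-trans b⊑C C⊑F
        F⊑ω : F ⊑ ω
        F⊑ω with ⊑-linear pC⊑F pC⊑ω
        ... | inj₁ p = p
        ... | inj₂ p = ⊥-elim (ω⋢F p)
        -- The path to `g'` crosses the bag of `F`, so `F` is near `g`; alive at `par b`, it would
        -- have beaten `C`.
        F∉pb : ¬ (F ∈ labels (par b))
        F∉pb F∈pb = <⇒≱ (≤-<-trans (dep-mono pC⊑F) dep-pC)
                        (oldestC F∈pb (near-path g∈ gg'≤R b⊑F F⊑ω))
        F∉b : ¬ (F ∈ labels b)
        F∉b F∈b with labels-inherit F∈b
        ... | inj₂ F∈pb = F∉pb F∈pb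
        ... | inj₁ refl = <⇒≱ (≤-<-trans (dep-mono pC⊑F) dep-pC) (dep-mono b⊑C)
        older : ∀ d → dep F ≤ d →
                Landing b ω g
        older d dF≤d with dropped (proj₁ b⊑C) b (proj₂ b⊑C) ⊑-refl F∈ F∉pb F∉b
        ... | c , b⊑c , c⊑C , F∈pc , F∉c with on-path b⊑c (⊑-trans c⊑C (⊑-trans C⊑F F⊑ω))
        ...   | u , u∈ , gu≤R , ug'≤R with labels-oldest u∈
        ...     | E , E∈ , nearE , oldestE = again d dF≤d
          where
          dE≤dF : dep E ≤ dep F
          dE≤dF = oldestE F∈pc (near-path u∈ ug'≤R (⊑-trans c⊑C C⊑F) F⊑ω)
          F⊑E : F ⊑ E
          F⊑E = ⊑-of-dep (⊑-trans c⊑C C⊑F) (labels-above E∈) dE≤dF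
          dE<dF : dep E < dep F
          dE<dF = dep-strict F⊑E λ { refl → F∉c E∈ }
          E∈pC : E ∈ labels (par C)
          E∈pC = labels-contiguous E∈ (⊑-trans c⊑C ⊑-par) (⊑-trans pC⊑F F⊑E)
          near-gE : ∃ λ m → m ∈ bag E × δ g m ≤ R + R
          near-gE = let m , m∈ , le = find nearE in
            m , m∈ , ≤-trans (δ-tri g u m) (+-mono-≤ gu≤R le)
          again : ∀ d → dep F ≤ d → Landing b ω g
          again zero le = ⊥-elim (<⇒≱ dE<dF (≤-trans le z≤n))
          again (suc d) le = chase d (≤-pred (≤-trans dE<dF le)) E∈pC near-gE

      start : Landing b ω g
      start with on-path (⊑-trans b⊑C ⊑-par) pC⊑ω
      ... | m , m∈ , gm≤R , _ with labels-oldest m∈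
      ...   | F , F∈ , nearF , _ =
        chase (dep F) ≤-refl F∈
          (let e , e∈ , le = find nearF in e , e∈ , ≤-trans (δ-tri g m e) (+-mono-≤ gm≤R le))

  -- Rooting the tree decomposition

  abstract
    least : ∀ {P : ℕ → Set} → (∀ j → Dec (P j)) → ∀ j → P j → ∃ λ i → P i × (∀ {j} → P j → i ≤ j)
    least {P} P? j pj with P? 0
    ... | yes p0 = 0 , p0 , λ _ → z≤n
    least {P} P? zero pj | no ¬p0 = ⊥-elim (¬p0 pj)
    least {P} P? (suc j) pj | no ¬p0 with least (P? ∘ suc) j pj
    ... | i , pi , min = suc i , pi , λ { {zero} p0 → ⊥-elim (¬p0 p0) ; {suc j} pj → s≤s (min pj) }

  module Trails {n : ℕ} {A : Set} (ends : A → Fin n × Fin n) (E : List A) where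

    Joined = Joins ends E
    W = Walk ends E

    edges : ∀ {u v} → W u v → List (Fin (length E))
    edges = edgesOf ends E

    joins? : ∀ i u w → Dec (Joined i u w)
    joins? i u w = ((_ ≟ᶠ _) ×-dec (_ ≟ᶠ _)) ⊎-dec ((_ ≟ᶠ _) ×-dec (_ ≟ᶠ _))

    joins-sym : ∀ {i u w} → Joined i u w → Joined i w u
    joins-sym = swap

    joins-ends : ∀ {i a w s s'} → Joined i a w → Joined i s s' → (a ≡ s × w ≡ s') ⊎ (a ≡ s' × w ≡ s)
    joins-ends (inj₁ (refl , refl)) (inj₁ (refl , refl)) = inj₁ (refl , refl)
    joins-ends (inj₁ (refl , refl)) (inj₂ (refl , refl)) = inj₂ (refl , refl)
    joins-ends (inj₂ (refl , refl)) (inj₁ (refl , refl)) = inj₂ (refl , refl)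
    joins-ends (inj₂ (refl , refl)) (inj₂ (refl , refl)) = inj₁ (refl , refl)

    Trail : List (Fin (length E)) → Fin n → Fin n → Set
    Trail is u v = Σ (W u v) λ q → Unique (edges q) × (∀ {i} → i ∈ edges q → i ∈ is)

    -- A walk that crosses the edge `i` visits its end `a`. The trail starts there, just before or
    -- just after that crossing according to its direction.
    trail-from : ∀ {i a w s b is} (q : W s b) → Unique (edges q) → (∀ {i} → i ∈ edges q → i ∈ is) →
                 i ∈ edges q → Joined i a w → Trail is a b
    trail-from (cons i' j q) uq@(_ ∷ u) sub (here refl) ja with joins-ends ja j
    ... | inj₁ (refl , _) = cons i' j q , uq , sub
    ... | inj₂ (refl , _) = q , u , sub ∘ there
    trail-from (cons i' j q) (_ ∷ u) sub (there i∈) ja = trail-from q u (sub ∘ there) i∈ ja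

    trail : ∀ {u v} (p : W u v) → Trail (edges p) u v
    trail nil = nil , [] , id
    trail (cons i j p) with trail p
    ... | q , uq , sub with memb? _≟ᶠ_ i (edges q)
    ...   | yes i∈ = trail-from q uq (there ∘ sub) i∈ j
    ...   | no i∉ = cons i j q , Allₚ.¬Any⇒All¬ _ i∉ ∷ uq , λ { (here e) → here e ; (there i∈) → there (sub i∈) }

    -- Every edge of a forest is a bridge: a walk avoiding it would shorten to a trail, which `i`
    -- closes to a nonempty closed trail.
    acyclic-edge : Acyclic ends E → ∀ {i u w} → Joined i u w → (p : W w u) → i ∈ edges p
    acyclic-edge acyc {i} {u} j p with memb? _≟ᶠ_ i (edges p)
    ... | yes i∈ = i∈
    ... | no i∉ with trail p
    ...   | q , uq , sub with acyc u (cons i j q) (Allₚ.¬Any⇒All¬ _ (i∉ ∘ sub) ∷ uq)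
    ...     | ()

    append : ∀ {u v w} → W u v → W v w → W u w
    append nil q = q
    append (cons i j p) q = cons i j (append p q)

    append-edges : ∀ {u v w} (p : W u v) (q : W v w) {i} → i ∈ edges (append p q) → i ∈ edges p ⊎ i ∈ edges q
    append-edges nil q i∈ = inj₂ i∈
    append-edges (cons i j p) q (here e) = inj₁ (here e)
    append-edges (cons i j p) q (there i∈) = [ inj₁ ∘ there , inj₂ ]′ (append-edges p q i∈)

    reverse : ∀ {u v} (p : W u v) → Σ (W v u) λ q → ∀ {i} → i ∈ edges q → i ∈ edges p
    reverse nil = nil , id
    reverse (cons i j p) with reverse p
    ... | q , sub = append q (cons i (joins-sym j) nil)
        , λ {i'} i∈ → [ there ∘ sub , (λ { (here e) → here e }) ]′ (append-edges q (cons i (joins-sym j) nil) i∈)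

  module RootedTree {k : ℕ} (E : List (Fin (suc k) × Fin (suc k))) (tree : IsTree id E) where
    open Trails {A = Fin (suc k) × Fin (suc k)} id E

    Node : Set
    Node = Fin (suc k)

    -- A walk of exactly `j` edges to the root. This is decidable, and the least such `j` is the
    -- breadth-first depth.
    Within : ℕ → Node → Set
    Within zero b = b ≡ zero
    Within (suc j) b = ∃₂ λ i w → Joined i b w × Within j w

    within? : ∀ j b → Dec (Within j b)
    within? zero b = b ≟ᶠ zero
    within? (suc j) b = any? λ i → any? λ w → joins? i b w ×-dec within? j w

    walk-within : ∀ {b} → W b zero → ∃ λ j → Within j b
    walk-within nil = 0 , refl
    walk-within (cons i j p) with walk-within p
    ... | l , wi = suc l , i , _ , j , wi

    distance : ∀ b → ∃ λ d → Within d b × (∀ {j} → Within j b → d ≤ j)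
    distance b = least (λ j → within? j b) _ (proj₂ (walk-within (proj₁ tree b zero)))

    dep : Node → ℕ
    dep b = proj₁ (distance b)

    record Up (b : Node) : Set where
      constructor up
      field
        edge   : Fin (length E)
        target : Node
        joins  : Joined edge b target
        higher : suc (dep target) ≡ dep b

    up? : ∀ b → (dep b ≡ 0 × b ≡ zero) ⊎ Up b
    up? b with distance b in eq
    ... | zero , b≡0 , _ = inj₁ (refl , b≡0)
    ... | suc d , (i , w , j , wi) , min = inj₂ (up i w j (trans (cong suc dep-w) (sym (cong proj₁ eq))))
      where
      dep-w : dep w ≡ d
      dep-w = ≤-antisym (proj₂ (proj₂ (distance w)) wi)
                (≤-pred (min {suc (dep w)} (i , w , j , proj₁ (proj₂ (distance w)))))

    par : Node → Node
    par b with up? b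
    ... | inj₁ _ = b
    ... | inj₂ u = Up.target u

    dep-par : ∀ b → dep (par b) ≡ pred (dep b)
    dep-par b with up? b
    ... | inj₁ (d≡0 , _) = trans d≡0 (sym (cong pred d≡0))
    ... | inj₂ u = cong pred (Up.higher u)

    dep-root : ∀ b → dep b ≡ 0 → b ≡ zero
    dep-root b d≡0 with up? b
    ... | inj₁ (_ , e) = e
    ... | inj₂ u = ⊥-elim (0≢1+n (trans (sym d≡0) (sym (Up.higher u))))

    root-dep : dep zero ≡ 0
    root-dep = n≤0⇒n≡0 (proj₂ (proj₂ (distance zero)) {0} refl)

    IsUpEdge : Fin (length E) → Node → Set
    IsUpEdge i b = Σ (Up b) λ u → up? b ≡ inj₂ u × i ≡ Up.edge u

    isUpEdge? : ∀ i b → Dec (IsUpEdge i b)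
    isUpEdge? i b with up? b
    ... | inj₁ _ = no λ ()
    ... | inj₂ u with i ≟ᶠ Up.edge u
    ...   | yes e = yes (u , refl , e)
    ...   | no ≢e = no λ { (_ , refl , e) → ≢e e }

    up-target : ∀ {i u w} → Joined i u w → IsUpEdge i u → par u ≡ w
    up-target {i} {u} {w} j (z , e , refl) with up? u
    up-target j (z , refl , refl) | inj₂ .z with joins-ends j (Up.joins z)
    ... | inj₁ (_ , w≡) = sym w≡
    ... | inj₂ (u≡ , refl) = ⊥-elim (1+n≢n (trans (cong (suc ∘ dep) u≡) (Up.higher z)))

    -- The climb uses only chosen upward edges, and `i` can be the upward edge of no node except its
    -- own ends.
    climb : ∀ {i u w} → Joined i u w → ¬ IsUpEdge i u → ¬ IsUpEdge i w →
            ∀ d b → dep b ≡ d → Σ (W b zero) λ p → ¬ (i ∈ edges p)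
    climb {i} {u} {w} j ¬u ¬w d b e with up? b in eq
    ... | inj₁ (_ , refl) = nil , λ ()
    ... | inj₂ z = go d e
      where
      i≢ : i ≢ Up.edge z
      i≢ refl with joins-ends j (Up.joins z)
      ... | inj₁ (refl , _) = ¬u (z , eq , refl)
      ... | inj₂ (_ , refl) = ¬w (z , eq , refl)
      go : ∀ d → dep b ≡ d → Σ (W b zero) λ p → ¬ (i ∈ edges p)
      go zero e = ⊥-elim (0≢1+n (trans (sym e) (sym (Up.higher z))))
      go (suc d) e with climb j ¬u ¬w d (Up.target z) (suc-injective (trans (Up.higher z) e))
      ... | p , i∉ = cons (Up.edge z) (Up.joins z) p , λ { (here i≡) → i≢ i≡ ; (there i∈) → i∉ i∈ }

    -- Otherwise both ends could climb to the root without the edge, and the two climbs together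
    -- would bypass a bridge.
    edge-vertical : ∀ {i u w} → Joined i u w → par u ≡ w ⊎ par w ≡ u
    edge-vertical {i} {u} {w} j with isUpEdge? i u | isUpEdge? i w
    ... | yes iu | _ = inj₁ (up-target j iu)
    ... | no _ | yes iw = inj₂ (up-target (joins-sym j) iw)
    ... | no ¬u | no ¬w with climb j ¬u ¬w _ u refl | climb j ¬u ¬w _ w refl
    ...   | p , i∉p | q , i∉q with reverse p
    ...     | p' , sub = ⊥-elim ([ i∉q , i∉p ∘ sub ]′
                           (append-edges q p' (acyclic-edge (proj₂ tree) j (append q p'))))

  -- The integer shortest-path metric

  module NatLength {n : ℕ} (G : WGraph n) (w : Fin (length G) → ℕ) where
    open Trails wends G using (joins-sym; append)

    natLen : ∀ {u v} → WWalk G u v → ℕ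
    natLen nil = 0
    natLen (cons i _ p) = w i + natLen p

    natLen-append : ∀ {u v x} (p : WWalk G u v) (q : WWalk G v x) →
                    natLen (append p q) ≡ natLen p + natLen q
    natLen-append nil q = refl
    natLen-append (cons i j p) q = trans (cong (w i +_) (natLen-append p q)) (sym (+-assoc (w i) _ _))

    reversed : ∀ {u v} (p : WWalk G u v) → Σ (WWalk G v u) λ q → natLen q ≡ natLen p
    reversed nil = nil , refl
    reversed (cons i j p) with reversed p
    ... | q , e = append q (cons i (joins-sym j) nil) , trans (natLen-append q _)
                    (trans (cong₂ _+_ e (+-identityʳ (w i))) (+-comm (natLen p) (w i)))

  module GraphMetric {n : ℕ} (G : WGraph n) (w : Fin (length G) → ℕ) (w>0 : ∀ i → 0 < w i)
                     (conn : Connected wends G) where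
    open Trails wends G using (Joined; joins?; append)
    open NatLength G w

    -- j bounds the length of the walk, and f its number of edges.
    HasWalk : ℕ → ℕ → Fin n → Fin n → Set
    HasWalk zero j u v = u ≡ v
    HasWalk (suc f) j u v = u ≡ v ⊎ ∃₂ λ i x → Joined i u x × w i ≤ j × HasWalk f (j ∸ w i) x v

    hasWalk? : ∀ f j u v → Dec (HasWalk f j u v)
    hasWalk? zero j u v = u ≟ᶠ v
    hasWalk? (suc f) j u v = (u ≟ᶠ v) ⊎-dec any? λ i → any? λ x →
      joins? i u x ×-dec (w i ≤? j) ×-dec hasWalk? f (j ∸ w i) x v

    walk-of : ∀ f j {u v} → HasWalk f j u v → Σ (WWalk G u v) λ p → natLen p ≤ j
    walk-of zero j refl = nil , z≤n
    walk-of (suc f) j (inj₁ refl) = nil , z≤n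
    walk-of (suc f) j (inj₂ (i , x , jn , wi≤ , hw)) with walk-of f (j ∸ w i) hw
    ... | p , le = cons i jn p , ≤-trans (+-monoʳ-≤ (w i) le) (≤-reflexive (m+[n∸m]≡n wi≤))

    -- Every edge weighs at least one, so a walk of length at most `j` has at most `j` edges. The
    -- existence of such a walk is thus a finite search, and distances are least witnesses.
    of-walk : ∀ {f j u v} (p : WWalk G u v) → natLen p ≤ j → j ≤ f → HasWalk f j u v
    of-walk {zero} nil le j≤f = refl
    of-walk {suc f} nil le j≤f = inj₁ refl
    of-walk {zero} (cons i jn p) le z≤n = ⊥-elim (<⇒≱ (w>0 i) (≤-trans (m≤m+n _ _) le))
    of-walk {suc f} {j} (cons i jn p) le j≤f = inj₂ (i , _ , jn , ≤-trans (m≤m+n _ _) le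
      , of-walk p (m+n≤o⇒m≤o∸n _ (≤-trans (≤-reflexive (+-comm _ (w i))) le))
          (≤-trans (∸-monoʳ-≤ j (w>0 i)) (≤-pred-∸ j≤f)))
      where
      ≤-pred-∸ : ∀ {j f} → j ≤ suc f → j ∸ 1 ≤ f
      ≤-pred-∸ {zero} _ = z≤n
      ≤-pred-∸ {suc j} (s≤s le) = le

    shortest : ∀ u v → ∃ λ d → HasWalk d d u v × (∀ {j} → HasWalk j j u v → d ≤ j)
    shortest u v = least (λ j → hasWalk? j j u v) _ (of-walk (conn u v) ≤-refl ≤-refl)

    δ : Fin n → Fin n → ℕ
    δ u v = proj₁ (shortest u v)

    δ≤ : ∀ {u v} (p : WWalk G u v) → δ u v ≤ natLen p
    δ≤ {u} {v} p = proj₂ (proj₂ (shortest u v)) (of-walk p ≤-refl ≤-refl)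

    geodesic : ∀ u v → Σ (WWalk G u v) λ p → natLen p ≤ δ u v
    geodesic u v = walk-of _ _ (proj₁ (proj₂ (shortest u v)))

    δ-separates : ∀ {d} → (∀ i → d ≤ w i) → ∀ x y → x ≢ y → d ≤ δ x y
    δ-separates d≤w x y x≢y with geodesic x y
    ... | nil , _ = ⊥-elim (x≢y refl)
    ... | cons i _ p , le = ≤-trans (d≤w i) (≤-trans (m≤m+n _ _) le)

    metric : Metric n
    metric = record
      { δ = δ
      ; δ-self = λ u → n≤0⇒n≡0 (δ≤ {u} nil)
      ; δ-sym = λ u v → ≤-antisym (half u v) (half v u)
      ; δ-tri = λ u v x → let p , p≤ = geodesic u v ; q , q≤ = geodesic v x in
          ≤-trans (δ≤ (append p q)) (≤-trans (≤-reflexive (natLen-append p q)) (+-mono-≤ p≤ q≤))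
      }
      where
      half : ∀ u v → δ u v ≤ δ v u
      half u v with geodesic v u
      ... | p , p≤ with reversed p
      ...   | q , e = ≤-trans (δ≤ q) (≤-trans (≤-reflexive e) p≤)

    module Decomposed {t} (TD : TreeDecomposition G t) where
      open TreeDecomposition TD
      module Tree = RootedTree tedges isTree
      open Tree using (edge-vertical)

      nodes : RootedNodes
      nodes = record { k = k ; root = zero ; par = Tree.par ; dep = Tree.dep ; dep-par = Tree.dep-par
                     ; root-dep = Tree.root-dep ; dep-root = Tree.dep-root }
      open RootedNodes nodes hiding (k)
      open Ancestors

      -- Tree edges are vertical, so a walk leaves the subtree below `c` only along the edge from
      -- `c` to `par c`, and `v` is in both bags.
      adhesion : ∀ {v b b' c} → b ⊑ c → ¬ (b' ⊑ c) → (p : Walk id tedges b b') →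
                 All (λ z → v ∈ bag z) (vertsOf id tedges p) → v ∈ bag c × v ∈ bag (par c)
      adhesion b⊑c b'⋢c nil _ = ⊥-elim (b'⋢c b⊑c)
      adhesion {b = b} {c = c} b⊑c b'⋢c (cons {w = z} i j p) (v∈b ∷ vs) with z ⊑? c
      ... | yes z⊑c = adhesion z⊑c b'⋢c p vs
      ... | no z⋢c with edge-vertical j
      ...   | inj₂ refl = ⊥-elim (z⋢c (⊑-trans ⊑-par b⊑c))
      ...   | inj₁ refl with b ≟ᶠ c
      ...     | yes refl = v∈b , first p vs
        where
        first : ∀ {v x y} (p : Walk id tedges x y) →
                All (λ z → v ∈ bag z) (vertsOf id tedges p) → v ∈ bag x
        first nil (v∈ ∷ _) = v∈
        first (cons _ _ _) (v∈ ∷ _) = v∈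
      ...     | no b≢c = ⊥-elim ([ b≢c , z⋢c ]′ (⊑-uncons b⊑c))

      -- Follow the walk as long as its edges are covered by bags below `c`. The first edge covered
      -- elsewhere starts at a vertex with bags on both sides, and coherence puts that vertex into
      -- the adhesion of `c`.
      split : ∀ {b b' c u v} → b ⊑ c → ¬ (b' ⊑ c) → u ∈ bag b → v ∈ bag b' → (p : WWalk G u v) →
              ∃ λ m → m ∈ bag c × m ∈ bag (par c) ×
              Σ (WWalk G u m) λ q → Σ (WWalk G m v) λ r → natLen q + natLen r ≡ natLen p
      split {b} {b'} {u = u} b⊑c b'⋢c u∈ v∈ nil with coherent u b b' u∈ v∈
      ... | p , vs = let m∈c , m∈p = adhesion b⊑c b'⋢c p vs in u , m∈c , m∈p , nil , nil , refl
      split {b} {b'} {c} {u} b⊑c b'⋢c u∈ v∈ (cons {w = x} i j p) with shared j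
        where
        shared : ∀ {i u x} → Joined i u x → ∃ λ b → u ∈ bag b × x ∈ bag b
        shared {i} (inj₁ (refl , refl)) = edgeCov i
        shared {i} (inj₂ (refl , refl)) = let b , e₁ , e₂ = edgeCov i in b , e₂ , e₁
      ... | b'' , u∈'' , x∈'' with b'' ⊑? c
      ...   | yes b''⊑c = let m , m∈c , m∈p , q , r , e = split b''⊑c b'⋢c x∈'' v∈ p in
        m , m∈c , m∈p , cons i j q , r , trans (+-assoc (w i) _ _) (cong (w i +_) e)
      ...   | no b''⋢c with coherent u b b'' u∈ u∈''
      ...     | pt , vs = let m∈c , m∈p = adhesion b⊑c b''⋢c pt vs in
        u , m∈c , m∈p , nil , cons i j p , refl

      rooted : RootedDecomposition metric t
      rooted = record
        { nodes = nodes ; bag = bag ; bagWidth = bagWidth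
        ; home = λ v → proj₁ (vertexCov v) ; home∈ = λ v → proj₂ (vertexCov v)
        ; sep = λ {_} {_} {_} {u} {v} b⊑c b'⋢c u∈ v∈ →
            let p , p≤ = geodesic u v
                m , m∈c , m∈p , q , r , e = split b⊑c b'⋢c u∈ v∈ p
            in m , m∈c , m∈p , ≤-trans (+-mono-≤ (δ≤ q) (δ≤ r)) (≤-trans (≤-reflexive e) p≤)
        }

  -- Hubs: common labels near a shortest path

  hops : ℕ → ℕ
  hops zero = 1
  hops (suc N) = 2 + hops N

  -- The innermost sum joins the searches from the two ends in `meet`; the two outer layers lift the
  -- hub until it is `Far` from one end and then from the other.
  reachBound : ℕ → ℕ
  reachBound N = suc (suc (suc (hops N) + hops N) + 1) + 1

  module Hubs {n t} {X : Metric n} (D : RootedDecomposition X t) (R : ℕ) where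
    open Metric X
    open RootedDecomposition D
    open Labels D R

    -- As long as the path leaves the subtree below `E` within `R` of `g`, the jump is made again
    -- from `g` with a higher target, so no hops pile up. Otherwise more than `R` of the path is
    -- behind and the search restarts at the exit point, which happens at most `N` times. Only the
    -- last jump contributes an error.
    climb : ∀ N {b b' g y} → g ∈ bag b → y ∈ bag b' → δ g y ≤ N * R →
            ∃ λ E → E ∈ reach (hops N) b × b' ⊑ E ×
            ∃₂ λ g' e → e ∈ bag E × δ g g' + δ g' y ≤ δ g y × δ g' e ≤ R + R
    climb N {b} {b'} {g} {y} g∈ y∈ gy≤ =
      go N (dep b) gy≤ ≤-refl ⊑-refl g∈ (≤-trans (≤-reflexive (δ-self g)) z≤n)
      where
      Result : ℕ → Set
      Result N = ∃ λ E → E ∈ reach (hops N) b × b' ⊑ E ×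
                 ∃₂ λ g' e → e ∈ bag E × δ g g' + δ g' y ≤ δ g y × δ g' e ≤ R + R

      hops≥1 : ∀ N → 1 ≤ hops N
      hops≥1 zero = s≤s z≤n
      hops≥1 (suc N) = s≤s z≤n

      go : ∀ N d {ω m} → δ g y ≤ N * R → dep ω ≤ d → b ⊑ ω → m ∈ bag ω → δ g m ≤ R → Result N
      go N d {ω} gy≤ dω≤d b⊑ω m∈ gm≤R with jump b⊑ω g∈ m∈ gm≤R
      ... | E , E∈ , ω⊑E , e , e∈ , ge≤ with b' ⊑? E
      ...   | yes b'⊑E = E , reach-mono (hops≥1 N) E∈ , b'⊑E , g , e , e∈
                       , ≤-reflexive (cong (_+ δ g y) (δ-self g)) , ge≤
      ...   | no b'⋢E with sep (reach-above 1 E∈) b'⋢E g∈ y∈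
      ...     | m' , _ , m'∈ , le with δ g m' ≤? R
      ...       | yes gm'≤R = again d dω≤d
        where
        dE : dep (par E) < dep ω
        dE with depth? E
        ... | inj₂ 0<d = ≤-trans (dep-par< 0<d) (dep-mono ω⊑E)
        ... | inj₁ refl = ⊥-elim (b'⋢E (⊑-root b'))
        again : ∀ d → dep ω ≤ d → Result N
        again zero le' = ⊥-elim (<⇒≱ dE (≤-trans le' z≤n))
        again (suc d) le' = go N d gy≤ (≤-pred (≤-trans dE le'))
                              (⊑-trans (reach-above 1 E∈) ⊑-par) m'∈ gm'≤R
      ...       | no gm'≰R = next N gy≤
        where
        next : ∀ N → δ g y ≤ N * R → Result N
        next zero gy≤0 =
          ⊥-elim (gm'≰R (≤-trans (m≤m+n _ _) (≤-trans le (≤-trans gy≤0 z≤n))))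
        next (suc N) gy≤ with climb N m'∈ y∈ m'y≤
          where
          m'y≤ : δ m' y ≤ N * R
          m'y≤ = +-cancelˡ-≤ R _ _ (≤-trans (+-monoˡ-≤ _ (<⇒≤ (≰⇒> gm'≰R))) (≤-trans le gy≤))
        ... | E' , E'∈ , b'⊑E' , g' , e' , e'∈ , le' , g'e'≤ =
          E' , reach-trans 1 (hops N) E∈ E'∈ , b'⊑E' , g' , e' , e'∈ , between , g'e'≤
          where
          open ≤-Reasoning
          between : δ g g' + δ g' y ≤ δ g y
          between = begin
            δ g g' + δ g' y               ≤⟨ +-monoˡ-≤ _ (δ-tri g m' g') ⟩
            δ g m' + δ m' g' + δ g' y     ≡⟨ +-assoc (δ g m') _ _ ⟩
            δ g m' + (δ m' g' + δ g' y)   ≤⟨ +-monoʳ-≤ (δ g m') le' ⟩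
            δ g m' + δ m' y               ≤⟨ le ⟩
            δ g y                         ∎

    record Hub (h : ℕ) (x y : Fin n) : Set where
      field
        node   : Node
        left   : node ∈ reach h (home x)
        right  : node ∈ reach h (home y)
        centre : Fin n
        c∈     : centre ∈ bag node
        excess : δ x centre + δ centre y ≤ δ x y + 6 * R

    open Hub

    Hub-sym : ∀ {h x y} → Hub h x y → Hub h y x
    Hub-sym {h} {x} {y} H = record
      { node = node H ; left = right H ; right = left H ; centre = centre H ; c∈ = c∈ H
      ; excess = subst₂ _≤_ e₁ (cong (_+ 6 * R) (δ-sym x y)) (excess H) }
      where
      e₁ : δ x (centre H) + δ (centre H) y ≡ δ y (centre H) + δ (centre H) x
      e₁ = trans (+-comm (δ x (centre H)) _) (cong₂ _+_ (δ-sym (centre H) y) (δ-sym x (centre H)))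

    near-geodesic : ∀ {x y g e} → δ x g + δ g y ≤ δ x y → δ g e ≤ 3 * R →
                    δ x e + δ e y ≤ δ x y + 6 * R
    near-geodesic {x} {y} {g} {e} le ge≤ = begin
      δ x e + δ e y                       ≤⟨ +-mono-≤ (δ-tri x g e) (δ-tri e g y) ⟩
      (δ x g + δ g e) + (δ e g + δ g y)   ≡⟨ cong (λ z → (δ x g + δ g e) + (z + δ g y)) (δ-sym e g) ⟩
      (δ x g + δ g e) + (δ g e + δ g y)   ≡⟨ lem (δ x g) (δ g e) (δ g y) ⟩
      (δ x g + δ g y) + 2 * δ g e         ≤⟨ +-mono-≤ le (*-monoʳ-≤ 2 ge≤) ⟩
      δ x y + 2 * (3 * R)                 ≡⟨ cong (δ x y +_) (sym (*-assoc 2 3 R)) ⟩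
      δ x y + 6 * R                       ∎
      where
      open ≤-Reasoning
      lem : ∀ a b c → (a + b) + (b + c) ≡ (a + c) + 2 * b
      lem = solve-∀

    2R≤3R : R + R ≤ 3 * R
    2R≤3R = +-monoʳ-≤ R (m≤m+n R _)

    -- The search from `b` towards `E` passes `par E'`, so by `reach-cross` it can be resumed there
    -- after `b'` has reached `E'`.
    meet-step : ∀ h {b b' E E'} → E ∈ reach h b → E' ∈ reach h b' → b ⊑ E' → E' ⊑ E →
                E ∈ reach (suc h + h) b'
    meet-step h {b} {b'} {E} {E'} E∈ E'∈ b⊑E' E'⊑E with ⊑-uncons E'⊑E
    ... | inj₁ refl = reach-mono (m≤n+m h (suc h)) E'∈
    ... | inj₂ pE'⊑E = reach-trans h h E'∈ (reach-cross h E∈ (⊑-trans b⊑E' ⊑-par) pE'⊑E)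

    meet : ∀ N {x y} → δ x y ≤ N * R → Hub (suc (hops N) + hops N) x y
    meet N {x} {y} xy≤ with climb N (home∈ x) (home∈ y) xy≤
                          | climb N (home∈ y) (home∈ x) (≤-trans (≤-reflexive (δ-sym y x)) xy≤)
    ... | E , E∈ , y⊑E , g , e , e∈ , le , ge≤ | E' , E'∈ , x⊑E' , g' , e' , e'∈ , le' , ge'≤
      with ⊑-linear (reach-above (hops N) E∈) x⊑E'
    ...   | inj₂ E'⊑E = record
      { node = E ; left = reach-mono (m≤n+m (hops N) (suc (hops N))) E∈
      ; right = meet-step (hops N) E∈ E'∈ x⊑E' E'⊑E
      ; centre = e ; c∈ = e∈ ; excess = near-geodesic le (≤-trans ge≤ 2R≤3R) }
    ...   | inj₁ E⊑E' = Hub-sym record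
      { node = E' ; left = reach-mono (m≤n+m (hops N) (suc (hops N))) E'∈
      ; right = meet-step (hops N) E'∈ E∈ y⊑E E⊑E'
      ; centre = e' ; c∈ = e'∈ ; excess = near-geodesic le' (≤-trans ge'≤ 2R≤3R) }

    -- By the separator property, the R-ball around v then lies entirely below C.
    Far : Fin n → Node → Set
    Far v C = C ≡ root ⊎ All (λ m → R < δ v m) (bag (par C))

    far? : ∀ v C → Dec (Far v C)
    far? v C = (C ≟ᶠ root) ⊎-dec All.all? (λ m → R <? δ v m) (bag (par C))

    ¬Far : ∀ {v C} → ¬ Far v C → 0 < dep C × ∃ λ m → m ∈ bag (par C) × δ v m ≤ R
    ¬Far {v} {C} ¬far with depth? C
    ... | inj₁ e = ⊥-elim (¬far (inj₁ e))
    ... | inj₂ 0<d with find (Allₚ.¬All⇒Any¬ (λ m → R <? δ v m) (bag (par C)) (λ a → ¬far (inj₂ a)))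
    ...   | m , m∈ , ≮ = 0<d , m , m∈ , ≮⇒≥ ≮

    -- A short path from `v` to the bag of `par C'` would cross the bag of `par C`, already within
    -- `R`.
    Far-mono : ∀ {v C C'} → home v ⊑ C → C ⊑ C' → Far v C → Far v C'
    Far-mono {v} {C} {C'} v⊑C C⊑C' far with far? v C'
    ... | yes far' = far'
    ... | no ¬far' with ¬Far ¬far'
    ...   | 0<d , m , m∈ , vm≤R with far
    ...     | inj₁ refl = inj₁ (sym (root-⊑ C⊑C'))
    ...     | inj₂ a with ⊑-uncons C⊑C'
    ...       | inj₁ refl = inj₂ a
    ...       | inj₂ pC⊑C'
      with crossing (⊑-trans v⊑C ⊑-par) (⊑-trans pC⊑C' ⊑-par) (home∈ v) m∈
    ...         | u , u∈ , le = ⊥-elim (<⇒≱ (All.lookup a u∈) (≤-trans (m≤m+n _ _) (≤-trans le vm≤R)))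

    -- Each attempt is a new jump out of the same bag `p` with a higher target, so the hops stay
    -- within `reach 1`. The error is `R` from `x` to the crossing of `p` and twice `R` for the
    -- jump.
    raise : ∀ d {x p ω g} → dep ω ≤ d → home x ⊑ p → p ⊑ ω → g ∈ bag ω → δ x g ≤ R →
            ∃ λ E → E ∈ reach 1 p × Far x E × ∃ λ e → e ∈ bag E × δ x e ≤ 3 * R
    raise d {x} {p} {ω} dω≤d x⊑p p⊑ω g∈ xg≤R with crossing x⊑p p⊑ω (home∈ x) g∈
    ... | m , m∈ , le with jump p⊑ω m∈ g∈ (≤-trans (m≤n+m _ _) (≤-trans le xg≤R))
    ...   | E , E∈ , ω⊑E , e , e∈ , me≤ with far? x E
    ...     | yes far = E , E∈ , far , e , e∈ , (begin
                δ x e           ≤⟨ δ-tri x m e ⟩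
                δ x m + δ m e   ≤⟨ +-mono-≤ (≤-trans (m≤m+n _ _) (≤-trans le xg≤R)) me≤ ⟩
                R + (R + R)     ≡⟨ cong (λ z → R + (R + z)) (sym (+-identityʳ R)) ⟩
                3 * R           ∎)
      where open ≤-Reasoning
    ...     | no ¬far with ¬Far ¬far
    ...       | 0<E , g' , g'∈ , xg'≤R = again d dω≤d
      where
      dE : dep (par E) < dep ω
      dE = ≤-trans (dep-par< 0<E) (dep-mono ω⊑E)
      again : ∀ d → dep ω ≤ d →
              ∃ λ E → E ∈ reach 1 p × Far x E × ∃ λ e → e ∈ bag E × δ x e ≤ 3 * R
      again zero le' = ⊥-elim (<⇒≱ dE (≤-trans le' z≤n))
      again (suc d) le' = raise d (≤-pred (≤-trans dE le')) x⊑p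
                            (⊑-trans (reach-above 1 E∈) ⊑-par) g'∈ xg'≤R

    raise-hub : ∀ h {x y} (H : Hub h x y) →
                Σ (Hub (suc h + 1) x y) λ H' → node H ⊑ node H' × Far x (node H')
    raise-hub h {x} {y} H with far? x (node H)
    ... | yes far = record
      { node = node H ; left = reach-mono le (left H) ; right = reach-mono le (right H)
      ; centre = centre H ; c∈ = c∈ H ; excess = excess H } , ⊑-refl , far
      where
      le : h ≤ suc h + 1
      le = ≤-trans (n≤1+n h) (m≤m+n (suc h) 1)
    ... | no ¬far with ¬Far ¬far
    ...   | 0<d , g , g∈ , xg≤R
      with raise (dep (par (node H))) ≤-refl (⊑-trans (reach-above h (left H)) ⊑-par) ⊑-refl g∈ xg≤R
    ...     | E , E∈ , far , e , e∈ , xe≤ = record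
      { node = E ; left = reach-trans h 1 (left H) E∈ ; right = reach-trans h 1 (right H) E∈
      ; centre = e ; c∈ = e∈
      -- The new centre is compared with `x` itself, so the old excess is discarded and repeated
      -- raising costs nothing more.
      ; excess = near-geodesic {g = x} (≤-reflexive (cong (_+ δ x y) (δ-self x))) xe≤ }
      , ⊑-trans ⊑-par (reach-above 1 E∈) , far

    hub : ∀ N {x y} → δ x y ≤ N * R →
          Σ (Hub (reachBound N) x y) λ H → Far x (node H) × Far y (node H)
    hub N {x} {y} xy≤ with raise-hub _ (meet N xy≤)
    ... | H , _ , farx with raise-hub _ (Hub-sym H)
    ...   | H' , H⊑H' , fary =
      Hub-sym H' , Far-mono (reach-above (suc (suc (hops N) + hops N) + 1) (left H)) H⊑H' farx , fary

  -- Colouring and the star forest of one scale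

  ¬all-below-length : (xs : List ℕ) → ¬ (∀ (i : Fin (suc (length xs))) → toℕ i ∈ xs)
  ¬all-below-length xs occurs
    with pigeonhole (n<1+n (length xs)) (λ i → Any.index (occurs i))
  ... | i , j , i<j , eq = <⇒≢ i<j (begin
      toℕ i                             ≡⟨ Anyₚ.lookup-index (occurs i) ⟩
      lookup xs (Any.index (occurs i))  ≡⟨ cong (lookup xs) eq ⟩
      lookup xs (Any.index (occurs j))  ≡⟨ sym (Anyₚ.lookup-index (occurs j)) ⟩
      toℕ j                             ∎)
    where open ≡-Reasoning

  abstract
    fresh : (xs : List ℕ) → ∃ λ m → m ≤ length xs × ¬ (m ∈ xs)
    fresh xs with any? {n = suc (length xs)} (λ i → ¬? (memb? _≟_ (toℕ i) xs))
    ... | yes (i , i∉) = toℕ i , ≤-pred (toℕ<n i) , i∉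
    ... | no ∄ = ⊥-elim (¬all-below-length xs λ i →
        decidable-stable (memb? _≟_ (toℕ i) xs) (λ i∉ → ∄ (i , i∉)))

    upperBound : ∀ {m} (f : Fin m → ℕ) → ∃ λ B → ∀ i → f i ≤ B
    upperBound {zero} f = 0 , λ ()
    upperBound {suc m} f with upperBound (λ i → f (suc i))
    ... | B , f≤B = f zero + B , λ { zero → m≤m+n _ _ ; (suc i) → ≤-trans (f≤B i) (m≤n+m B (f zero)) }

  nth : ∀ {A : Set} → List A → ℕ → A → A
  nth [] j d = d
  nth (a ∷ as) zero d = a
  nth (a ∷ as) (suc j) d = nth as j d

  ∈⇒nth : ∀ {A : Set} {a : A} {as} → a ∈ as → ∃ λ j → j < length as × ∀ d → nth as j d ≡ a
  ∈⇒nth (here refl) = 0 , z<s , λ _ → refl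
  ∈⇒nth (there a∈) with ∈⇒nth a∈
  ... | j , j< , eq = suc j , s<s j< , eq

  module OneScale {n t} {X : Metric n} (D : RootedDecomposition X t) (φ N h : ℕ)
                  (h≡ : reachBound N ≡ h) where
    open Metric X
    open RootedDecomposition D
    open Labels D (φ + φ)
    open Hubs D (φ + φ)
    open Hub

    Proper : ℕ → (Node → ℕ) → Set
    Proper d col = ∀ {C E} → 0 < dep C → dep C < d → E ∈ reach h (par C) → col C ≢ col E

    -- Greedy, by depth: everything reachable from `par b` lies strictly above `b` and is already
    -- coloured, and `reach-length` leaves one colour free.
    colouringTo : ∀ d → ∃ λ col → (∀ b → col b < (2 + t) ^ suc h) × Proper d col
    colouringTo zero = (λ _ → 0) , (λ _ → m^n>0 (2 + t) (suc h)) , λ _ ()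
    colouringTo (suc d) with colouringTo d
    ... | col , col< , proper = col' , col'< , proper'
      where
      new : Node → ℕ
      new b = proj₁ (fresh (map col (reach h (par b))))
      col' : Node → ℕ
      col' b with dep b ≟ d
      ... | yes _ = new b
      ... | no _ = col b
      col'< : ∀ b → col' b < (2 + t) ^ suc h
      col'< b with dep b ≟ d
      ... | yes _ = ≤-trans (s≤s (proj₁ (proj₂ (fresh (map col (reach h (par b)))))))
                      (≤-trans (s≤s (≤-reflexive (length-map col (reach h (par b)))))
                        (reach-length h (par b)))
      ... | no _ = col< b
      old : ∀ {C E} → 0 < dep C → dep C ≤ d → E ∈ reach h (par C) → col' E ≡ col E
      old {C} {E} 0<C C≤d E∈ with dep E ≟ d
      ... | no _ = refl
      ... | yes e = ⊥-elim (<⇒≱ (≤-<-trans (dep-mono (reach-above h E∈)) (dep-par< 0<C))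
                             (≤-trans C≤d (≤-reflexive (sym e))))
      proper' : Proper (suc d) col'
      proper' {C} {E} 0<C C<1+d E∈ eq with trans eq (old 0<C (≤-pred C<1+d) E∈)
      ... | eq' with dep C ≟ d
      ...   | yes _ = proj₂ (proj₂ (fresh (map col (reach h (par C)))))
                        (subst (λ z → z ∈ map col (reach h (par C))) (sym eq') (∈-map⁺ col E∈))
      ...   | no ≢d = proper 0<C (≤∧≢⇒< (≤-pred C<1+d) ≢d) E∈ eq'

    maxDep : ∃ λ B → ∀ b → dep b ≤ B
    maxDep = upperBound dep

    colouring = colouringTo (suc (proj₁ maxDep))
    col = proj₁ colouring

    col-proper : ∀ {C E} → 0 < dep C → E ∈ reach h (par C) → col C ≢ col E
    col-proper {C} 0<C = proj₂ (proj₂ colouring) 0<C (s≤s (proj₂ maxDep C))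

    Serves : ℕ → Fin n → Node → Set
    Serves a u C = col C ≡ a × ∃ λ v → δ u v ≤ φ × C ∈ reach h (home v) × Far v C

    serves? : ∀ a u C → Dec (Serves a u C)
    serves? a u C = (col C ≟ a) ×-dec
      any? λ v → (δ u v ≤? φ) ×-dec (memb? _≟ᶠ_ C (reach h (home v)) ×-dec far? v C)

    Far-below : ∀ {v v' C} → home v ⊑ C → Far v C → δ v v' ≤ φ + φ → home v' ⊑ C
    Far-below {v} {v'} {C} v⊑C far vv'≤ with home v' ⊑? C | far
    ... | yes v'⊑C | _ = v'⊑C
    ... | no v'⋢C | inj₁ refl = ⊑-root (home v')
    ... | no v'⋢C | inj₂ a with sep v⊑C v'⋢C (home∈ v) (home∈ v')
    ...   | m , _ , m∈ , le =
      ⊥-elim (<⇒≱ (All.lookup a m∈) (≤-trans (m≤m+n _ _) (≤-trans le vv'≤)))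

    same-colour : ∀ {C C' b} → b ⊑ C → C ⊑ C' → C' ∈ reach h b → col C ≡ col C' → C ≡ C'
    same-colour {C} {C'} {b} b⊑C C⊑C' C'∈ eq with ⊑-uncons C⊑C'
    ... | inj₁ C≡C' = C≡C'
    ... | inj₂ pC⊑C' with depth? C
    ...   | inj₁ refl = root-⊑ C⊑C'
    ...   | inj₂ 0<C =
      ⊥-elim (col-proper 0<C (reach-cross h C'∈ (⊑-trans b⊑C ⊑-par) pC⊑C') eq)

    -- The two witnesses are within `φ + φ` of each other, the radius used in `Far`, so each has its
    -- home below both nodes. The nodes are then comparable, and the upper one is reachable from
    -- just above the lower one, where the colouring forbids equal colours.
    Serves-unique : ∀ {a u C C'} → Serves a u C → Serves a u C' → C ≡ C'
    Serves-unique {a} {u} {C} {C'} (refl , v , uv≤ , C∈ , far) (eq , v' , uv'≤ , C'∈ , far') =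
      [ (λ C⊑C' → same-colour v'⊑C C⊑C' C'∈ (sym eq))
      , (λ C'⊑C → sym (same-colour v⊑C' C'⊑C C∈ eq)) ]′ (⊑-linear (reach-above h C∈) v⊑C')
      where
      vv'≤ : δ v v' ≤ φ + φ
      vv'≤ = ≤-trans (δ-tri v u v') (+-mono-≤ (≤-trans (≤-reflexive (δ-sym v u)) uv≤) uv'≤)
      v'⊑C : home v' ⊑ C
      v'⊑C = Far-below (reach-above h C∈) far vv'≤
      v⊑C' : home v ⊑ C'
      v⊑C' = Far-below (reach-above h C'∈) far' (≤-trans (≤-reflexive (δ-sym v' v)) vv'≤)

    -- A displaced vertex is within φ of one end, the ends are at most 2Nφ apart and the hub adds
    -- 12φ; the constant 14 leaves one φ of slack.
    linkBound : ℕ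
    linkBound = (2 * N + 14) * φ

    abstract
      -- The cut-off keeps the link short even where this colour and position help nobody at this
      -- scale; staying put is the fallback in every failing case.
      step : ℕ → ℕ → Fin n → Fin n
      step a j u with any? (serves? a u)
      ... | no _ = u
      ... | yes (C , _) with δ u (nth (bag C) j u) ≤? linkBound
      ...   | yes _ = nth (bag C) j u
      ...   | no _ = u

      step-short : ∀ a j u → δ u (step a j u) ≤ linkBound
      step-short a j u with any? (serves? a u)
      ... | no _ = ≤-trans (≤-reflexive (δ-self u)) z≤n
      ... | yes (C , _) with δ u (nth (bag C) j u) ≤? linkBound
      ...   | yes le = le
      ...   | no _ = ≤-trans (≤-reflexive (δ-self u)) z≤n

      step-serves : ∀ {a j u C e} → Serves a u C → nth (bag C) j u ≡ e → δ u e ≤ linkBound → step a j u ≡ e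
      step-serves {a} {j} {u} {C} {e} s refl le with any? (serves? a u)
      ... | no ∄ = ⊥-elim (∄ (C , s))
      ... | yes (C' , s') with Serves-unique s s'
      ...   | refl with δ u (nth (bag C) j u) ≤? linkBound
      ...     | yes _ = refl
      ...     | no ≰ = ⊥-elim (≰ le)

    -- The last clause speaks of whole φ-balls, since `x` and `y` arrive at this scale as displaced
    -- vertices.
    Linked : Fin n → Fin n → Set
    Linked x y = ∃ λ a → a < (2 + t) ^ suc h × ∃ λ j → j < suc t × ∃ λ e →
      δ x e + δ e y ≤ δ x y + 12 * φ × (∀ u → δ x u ≤ φ ⊎ δ y u ≤ φ → step a j u ≡ e)

    hub-joins : ∀ {x y} → δ x y ≤ N * (φ + φ) → (H : Hub h x y) → Far x (node H) → Far y (node H) →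
                (∃ λ j → j < length (bag (node H)) × ∀ d → nth (bag (node H)) j d ≡ centre H) → Linked x y
    hub-joins {x} {y} xy≤ H farx fary (j , j< , nth≡) =
      col (node H) , proj₁ (proj₂ colouring) (node H) , j , ≤-trans j< (bagWidth (node H)) , e , excess' , joins
      where
      open ≤-Reasoning
      e = centre H
      excess' : δ x e + δ e y ≤ δ x y + 12 * φ
      excess' = ≤-trans (excess H) (≤-reflexive (cong (δ x y +_) (lem φ)))
        where
        lem : ∀ φ → 6 * (φ + φ) ≡ 12 * φ
        lem = solve-∀
      total : φ + (δ x y + 12 * φ) ≤ linkBound
      total = begin
        φ + (δ x y + 12 * φ)            ≤⟨ +-monoʳ-≤ φ (+-monoˡ-≤ (12 * φ) xy≤) ⟩
        φ + (N * (φ + φ) + 12 * φ)      ≤⟨ m≤n+m _ φ ⟩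
        φ + (φ + (N * (φ + φ) + 12 * φ)) ≡⟨ lem N φ ⟩
        linkBound                       ∎
        where
        lem : ∀ N φ → φ + (φ + (N * (φ + φ) + 12 * φ)) ≡ (2 * N + 14) * φ
        lem = solve-∀
      joins : ∀ u → δ x u ≤ φ ⊎ δ y u ≤ φ → step (col (node H)) j u ≡ e
      joins u (inj₁ xu≤) = step-serves {j = j}
        (refl , x , ≤-trans (≤-reflexive (δ-sym u x)) xu≤ , left H , farx) (nth≡ u) (begin
          δ u e                   ≤⟨ δ-tri u x e ⟩
          δ u x + δ x e           ≤⟨ +-mono-≤ (≤-trans (≤-reflexive (δ-sym u x)) xu≤) (≤-trans (m≤m+n _ _) excess') ⟩
          φ + (δ x y + 12 * φ)    ≤⟨ total ⟩
          linkBound               ∎)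
      joins u (inj₂ yu≤) = step-serves {j = j}
        (refl , y , ≤-trans (≤-reflexive (δ-sym u y)) yu≤ , right H , fary) (nth≡ u) (begin
          δ u e                   ≤⟨ δ-tri u y e ⟩
          δ u y + δ y e           ≤⟨ +-mono-≤ (≤-trans (≤-reflexive (δ-sym u y)) yu≤)
                                       (≤-trans (≤-reflexive (δ-sym y e)) (≤-trans (m≤n+m _ _) excess')) ⟩
          φ + (δ x y + 12 * φ)    ≤⟨ total ⟩
          linkBound               ∎)

    step-joins : ∀ x y → δ x y ≤ N * (φ + φ) → Linked x y
    step-joins x y xy≤ =
      let H , farx , fary = subst (λ h → Σ (Hub h x y) λ H → Far x (node H) × Far y (node H)) h≡ (hub N xy≤)
      in hub-joins xy≤ H farx fary (∈⇒nth (c∈ H))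

  -- Levelled trees

  Unique⇒lookup-injective : ∀ {A : Set} {xs : List A} → Unique xs →
                            ∀ {i j} → lookup xs i ≡ lookup xs j → i ≡ j
  Unique⇒lookup-injective (_ ∷ _) {zero} {zero} _ = refl
  Unique⇒lookup-injective (x≢ ∷ _) {zero} {suc j} e = ⊥-elim (All.lookup x≢ (∈-lookup j) e)
  Unique⇒lookup-injective (x≢ ∷ _) {suc i} {zero} e = ⊥-elim (All.lookup x≢ (∈-lookup i) (sym e))
  Unique⇒lookup-injective (_ ∷ u) {suc i} {suc j} e = cong suc (Unique⇒lookup-injective u e)

  module ParentTree {n : ℕ} (X : Metric n) (wt : ℕ → ℚ) {m : ℕ} (parent : Fin m → Fin (suc m))
                    (rank : Fin (suc m) → ℕ) (rank< : ∀ j → rank (parent j) < rank (suc j))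
                    (label : Fin (suc m) → Fin n) where
    open Metric X

    natCost : Fin m → ℕ
    natCost j = δ (label (suc j)) (label (parent j))

    arc : Fin m → WEdge (suc m)
    arc j = suc j , parent j , wt (natCost j)

    tree : WGraph (suc m)
    tree = tabulate arc

    open Trails wends tree using (Joined; append; joins-sym; reverse)

    owner : ∀ i → ∃ λ j → lookup tree i ≡ arc j
    owner i = ∈-tabulate⁻ (∈-lookup {xs = tree} i)

    index : ∀ j → ∃ λ i → arc j ≡ lookup tree i
    index j = Any.index j∈ , Anyₚ.lookup-index j∈
      where
      j∈ : arc j ∈ tree
      j∈ = ∈-tabulate⁺ {f = arc} j

    owner-injective : ∀ {i i'} → proj₁ (owner i) ≡ proj₁ (owner i') → i ≡ i'
    owner-injective {i} {i'} e = Unique⇒lookup-injective (Uniqueₚ.tabulate⁺ (Finₚ.suc-injective ∘ cong proj₁))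
      (trans (proj₂ (owner i)) (trans (cong arc e) (sym (proj₂ (owner i')))))

    child : Fin (length tree) → Fin (suc m)
    child i = suc (proj₁ (owner i))

    above : Fin (length tree) → Fin (suc m)
    above i = parent (proj₁ (owner i))

    orient : ∀ {i u w} → Joined i u w → (u ≡ child i × w ≡ above i) ⊎ (u ≡ above i × w ≡ child i)
    orient {i} (inj₁ (p , q)) = inj₁ ( trans (sym p) (cong proj₁ (proj₂ (owner i)))
                                     , trans (sym q) (cong (proj₁ ∘ proj₂) (proj₂ (owner i))))
    orient {i} (inj₂ (p , q)) = inj₂ ( trans (sym q) (cong (proj₁ ∘ proj₂) (proj₂ (owner i)))
                                     , trans (sym p) (cong proj₁ (proj₂ (owner i))))

    child-injective : ∀ {i i'} → child i ≡ child i' → i ≡ i'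
    child-injective e = owner-injective (Finₚ.suc-injective e)

    falling : ∀ i → rank (above i) < rank (child i)
    falling i = rank< (proj₁ (owner i))

    edges : ∀ {u v} → WWalk tree u v → List (Fin (length tree))
    edges = edgesOf wends tree

    -- Without its parent edge a trail can leave `child i` only downwards, and it has then just used
    -- the parent edge of its new vertex; so it descends to the end.
    descends : ∀ {i u v} → u ≡ child i → (q : WWalk tree u v) → ¬ (i ∈ edges q) → Unique (edges q) →
               u ≡ v ⊎ rank u < rank v
    descends u≡ nil i∉ _ = inj₁ refl
    descends {i} u≡ (cons i' j q) i∉ (i'∉ ∷ uq) with orient j
    ... | inj₁ (u≡' , _) = ⊥-elim (i∉ (here (child-injective (trans (sym u≡) u≡'))))
    ... | inj₂ (refl , refl) with descends refl q (λ i∈ → All.lookup i'∉ i∈ refl) uq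
    ...   | inj₁ refl = inj₂ (falling i')
    ...   | inj₂ lt = inj₂ (<-trans (falling i') lt)

    -- Reaching `child i` without its parent edge means coming from below. A trail that once
    -- descends keeps descending and would arrive from above, so this one only climbs.
    ascends : ∀ {i u v} → v ≡ child i → (q : WWalk tree u v) → ¬ (i ∈ edges q) → Unique (edges q) →
              rank v ≤ rank u
    ascends v≡ nil i∉ _ = ≤-refl
    ascends {i} v≡ (cons i' j q) i∉ (i'∉ ∷ uq) with orient j | ascends v≡ q (i∉ ∘ there) uq
    ... | inj₁ (refl , refl) | le = ≤-trans le (<⇒≤ (falling i'))
    ... | inj₂ (refl , refl) | le with descends refl q (λ i∈ → All.lookup i'∉ i∈ refl) uq
    ...   | inj₁ e = ⊥-elim (i∉ (here (child-injective (trans (sym v≡) (sym e)))))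
    ...   | inj₂ lt = ⊥-elim (<⇒≱ lt le)

    acyclic : Acyclic wends tree
    acyclic v nil _ = refl
    acyclic v (cons i j q) (i∉ ∷ uq) with orient j
    ... | inj₁ (refl , refl) =
      ⊥-elim (<⇒≱ (falling i) (ascends refl q (λ i∈ → All.lookup i∉ i∈ refl) uq))
    ... | inj₂ (refl , refl) with descends refl q (λ i∈ → All.lookup i∉ i∈ refl) uq
    ...   | inj₁ e = ⊥-elim (<⇒≢ (falling i) (sym (cong rank e)))
    ...   | inj₂ lt = ⊥-elim (<⇒≱ lt (<⇒≤ (falling i)))

    to-parent : ∀ j → Joined (proj₁ (index j)) (suc j) (parent j)
    to-parent j = inj₁ (cong proj₁ (sym e) , cong (proj₁ ∘ proj₂) (sym e))
      where e = proj₂ (index j)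

    connected : Connected wends tree
    connected x y = append (to-root _ x ≤-refl) (proj₁ (reverse (to-root _ y ≤-refl)))
      where
      to-root : ∀ d x → rank x ≤ d → WWalk tree x zero
      to-root d zero le = nil
      to-root zero (suc j) le = ⊥-elim (<⇒≱ (rank< j) (≤-trans le z≤n))
      to-root (suc d) (suc j) le =
        cons (proj₁ (index j)) (to-parent j) (to-root d (parent j) (≤-pred (≤-trans (rank< j) le)))

    natWeight : Fin (length tree) → ℕ
    natWeight i = natCost (proj₁ (owner i))

    weight-tree : ∀ i → weight (lookup tree i) ≡ wt (natWeight i)
    weight-tree i = cong weight (proj₂ (owner i))

    open NatLength tree natWeight public

    dominates : ∀ {a b} (p : WWalk tree a b) → δ (label a) (label b) ≤ natLen p
    dominates {a} nil = ≤-reflexive (δ-self (label a))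
    dominates {a} {b} (cons {w = c} i j p) =
      ≤-trans (δ-tri (label a) (label c) (label b)) (+-mono-≤ (≤-reflexive (edge j)) (dominates p))
      where
      edge : ∀ {a c} → Joined i a c → δ (label a) (label c) ≡ natWeight i
      edge j with orient j
      ... | inj₁ (refl , refl) = refl
      ... | inj₂ (refl , refl) = δ-sym _ _

    parent-walk : ∀ j → Σ (WWalk tree (suc j) (parent j)) λ p → natLen p ≡ natCost j
    parent-walk j = cons (proj₁ (index j)) (to-parent j) nil , trans (+-identityʳ _) (cong natCost j'≡j)
      where
      j'≡j : proj₁ (owner (proj₁ (index j))) ≡ j
      j'≡j = Finₚ.suc-injective (cong proj₁
        (trans (sym (proj₂ (owner (proj₁ (index j))))) (sym (proj₂ (index j)))))

    walk-+ : ∀ {a b c i j} → Σ (WWalk tree a b) (λ p → natLen p ≡ i) →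
             Σ (WWalk tree b c) (λ p → natLen p ≡ j) →
             Σ (WWalk tree a c) λ p → natLen p ≡ i + j
    walk-+ (p , p≡) (q , q≡) = append p q , trans (natLen-append p q) (cong₂ _+_ p≡ q≡)

    walk-back : ∀ {a b i} → Σ (WWalk tree a b) (λ p → natLen p ≡ i) → Σ (WWalk tree b a) λ p → natLen p ≡ i
    walk-back (p , p≡) = proj₁ (reversed p) , trans (proj₂ (reversed p)) p≡

  module Journey {n : ℕ} (X : Metric n) (f : ℕ → Fin n → Fin n) where
    open Metric X

    position : ℕ → Fin n → Fin n
    position zero x = x
    position (suc i) x = f i (position i x)

    travel : ℕ → Fin n → ℕ
    travel zero x = 0
    travel (suc i) x = travel i x + δ (position i x) (position (suc i) x)

  -- Each level is a full copy of the vertex set, level 0 holding the original points and `f i`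
  -- linking level `i` to the next. The extra root `zero` joins the top level into one tree; two
  -- points meet as soon as their positions agree at some level.
  module LevelledTree {n : ℕ} (X : Metric n) (v₀ : Fin n) (I' : ℕ) (f : ℕ → Fin n → Fin n)
                      (wt : ℕ → ℚ) where
    open Metric X
    open Journey X f

    I : ℕ
    I = suc I'

    m : ℕ
    m = I * n

    level : Fin m → ℕ
    level j = toℕ (proj₁ (remQuot {I} n j))

    vertex : Fin m → Fin n
    vertex j = proj₂ (remQuot {I} n j)

    node : ∀ {i} → i < I → Fin n → Fin (suc m)
    node lt u = suc (combine (fromℕ< lt) u)

    label : Fin (suc m) → Fin n
    label zero = v₀
    label (suc j) = vertex j

    rank : Fin (suc m) → ℕ
    rank zero = 0
    rank (suc j) = I ∸ level j

    parent : Fin m → Fin (suc m)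
    parent j with suc (level j) <? I
    ... | yes lt = node lt (f (level j) (vertex j))
    ... | no _ = zero

    level-node : ∀ {i} (lt : i < I) u → level (combine (fromℕ< lt) u) ≡ i
    level-node lt u = trans (cong (toℕ ∘ proj₁) (remQuot-combine {I} (fromℕ< lt) u)) (toℕ-fromℕ< lt)

    vertex-node : ∀ {i} (lt : i < I) u → vertex (combine (fromℕ< lt) u) ≡ u
    vertex-node lt u = cong proj₂ (remQuot-combine {I} (fromℕ< lt) u)

    rank< : ∀ j → rank (parent j) < rank (suc j)
    rank< j with suc (level j) <? I
    ... | yes lt = subst (λ z → I ∸ z < I ∸ level j) (sym (level-node lt _))
                     (∸-monoʳ-< (n<1+n (level j)) (<⇒≤ lt))
    ... | no _ = m<n⇒0<n∸m (toℕ<n (proj₁ (remQuot {I} n j)))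

    open ParentTree X wt parent rank rank< label public

    emb : Fin n → Fin (suc m)
    emb = node z<s

    emb-injective : ∀ {x y} → emb x ≡ emb y → x ≡ y
    emb-injective {x} {y} e = combine-injectiveʳ (fromℕ< {0} {I} z<s) x (fromℕ< {0} {I} z<s) y (Finₚ.suc-injective e)

    label-emb : ∀ x → label (emb x) ≡ x
    label-emb = vertex-node z<s

    parent-node : ∀ {i} (lt : i < I) (lt' : suc i < I) u →
                  parent (combine (fromℕ< lt) u) ≡ node lt' (f i u)
    parent-node {i} lt lt' u with suc (level (combine (fromℕ< lt) u)) <? I
    ... | no ≮ = ⊥-elim (≮ (subst (λ z → suc z < I) (sym (level-node lt u)) lt'))
    ... | yes lt'' = cong suc (cong₂ combine
          (toℕ-injective (trans (toℕ-fromℕ< lt'')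
            (trans (cong suc (level-node lt u)) (sym (toℕ-fromℕ< lt')))))
          (cong₂ f (level-node lt u) (vertex-node lt u)))

    ride : ∀ x i (lt : i < I) → Σ (WWalk tree (emb x) (node lt (position i x))) λ p → natLen p ≡ travel i x
    ride x zero (s≤s z≤n) = nil , refl
    ride x (suc i) lt' = walk-+ (ride x i lt)
      (subst₂ (λ a c → Σ (WWalk tree (node lt (position i x)) a) λ p → natLen p ≡ c) target
         (cong₂ δ (vertex-node lt (position i x))
                  (trans (cong label target) (vertex-node lt' (position (suc i) x))))
         (parent-walk (combine (fromℕ< lt) (position i x))))
      where
      lt = <-trans (n<1+n i) lt'
      target : parent (combine (fromℕ< lt) (position i x)) ≡ node lt' (position (suc i) x)
      target = parent-node lt lt' (position i x)

    meeting-walk : ∀ {x y i} → i < I → position i x ≡ position i y →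
                   Σ (WWalk tree (emb x) (emb y)) λ p → natLen p ≡ travel i x + travel i y
    meeting-walk {x} {y} {i} lt e = walk-+ (ride x i lt)
      (subst (λ z → Σ (WWalk tree (node lt z) (emb y)) λ p → natLen p ≡ travel i y) (sym e)
        (walk-back (ride y i lt)))

  -- Rational weights

  abstract
    ι : ℕ → ℚ
    ι a = ℤ.+ a ℚ./ 1

    ιᵘ : ∀ a → ℚ.toℚᵘ (ι a) ≃ mkℚᵘ (ℤ.+ a) 0
    ιᵘ a = ℚ.toℚᵘ-fromℚᵘ (mkℚᵘ (ℤ.+ a) 0)

  ι-* : ∀ a b → ι (a * b) ≡ ι a ℚ.* ι b
  ι-* a b = ℚ.toℚᵘ-injective (begin-equality
    ℚ.toℚᵘ (ι (a * b))                 ≃⟨ ιᵘ (a * b) ⟩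
    mkℚᵘ (ℤ.+ (a * b)) 0               ≡⟨ cong (λ z → mkℚᵘ z 0) (ℤ.pos-* a b) ⟩
    mkℚᵘ (ℤ.+ a) 0 ℚᵘ.* mkℚᵘ (ℤ.+ b) 0     ≃⟨ ℚᵘ.*-cong (ιᵘ a) (ιᵘ b) ⟨
    ℚ.toℚᵘ (ι a) ℚᵘ.* ℚ.toℚᵘ (ι b)         ≃⟨ ℚ.toℚᵘ-homo-* (ι a) (ι b) ⟨
    ℚ.toℚᵘ (ι a ℚ.* ι b)                   ∎)
    where open ℚᵘ.≤-Reasoning

  ι-+ : ∀ a b → ι (a + b) ≡ ι a ℚ.+ ι b
  ι-+ a b = ℚ.toℚᵘ-injective (begin-equality
    ℚ.toℚᵘ (ι (a + b))                 ≃⟨ ιᵘ (a + b) ⟩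
    mkℚᵘ (ℤ.+ (a + b)) 0
      ≡⟨ cong (λ z → mkℚᵘ z 0) (cong₂ ℤ._+_ (sym (ℤ.*-identityʳ (ℤ.+ a))) (sym (ℤ.*-identityʳ (ℤ.+ b)))) ⟩
    mkℚᵘ (ℤ.+ a) 0 ℚᵘ.+ mkℚᵘ (ℤ.+ b) 0     ≃⟨ ℚᵘ.+-cong (ιᵘ a) (ιᵘ b) ⟨
    ℚ.toℚᵘ (ι a) ℚᵘ.+ ℚ.toℚᵘ (ι b)         ≃⟨ ℚ.toℚᵘ-homo-+ (ι a) (ι b) ⟨
    ℚ.toℚᵘ (ι a ℚ.+ ι b)                   ∎)
    where open ℚᵘ.≤-Reasoning

  ι-mono : ∀ {a b} → a ≤ b → ι a ℚ.≤ ι b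
  ι-mono {a} {b} a≤b = ℚ.toℚᵘ-cancel-≤ (begin
    ℚ.toℚᵘ (ι a)    ≃⟨ ιᵘ a ⟩
    mkℚᵘ (ℤ.+ a) 0
      ≤⟨ ℚᵘ.*≤* (subst₂ ℤ._≤_ (sym (ℤ.*-identityʳ (ℤ.+ a))) (sym (ℤ.*-identityʳ (ℤ.+ b))) (+≤+ a≤b)) ⟩
    mkℚᵘ (ℤ.+ b) 0  ≃⟨ ιᵘ b ⟨
    ℚ.toℚᵘ (ι b)    ∎)
    where open ℚᵘ.≤-Reasoning

  ι-zero : ι 0 ≡ 0ℚ
  ι-zero = ℚ.toℚᵘ-injective (ιᵘ 0)

  0≤ι : ∀ a → 0ℚ ℚ.≤ ι a
  0≤ι a = ℚ.≤-trans (ℚ.≤-reflexive (sym ι-zero)) (ι-mono z≤n)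

  ι-positive : ∀ {a} → 0 < a → ℚ.Positive (ι a)
  ι-positive {suc a} _ =
    ℚ.positive (ℚ.toℚᵘ-cancel-< (ℚᵘ.<-respʳ-≃ (ℚᵘ.≃-sym (ιᵘ (suc a))) (ℚᵘ.*<* (+<+ z<s))))

  positive-numerator : ∀ {c} → 0ℚ ℚ.< c → 0 < ∣ ↥ c ∣
  positive-numerator {mkℚ (ℤ.+ zero) d-1 _} (*<* (+<+ ()))
  positive-numerator {mkℚ (ℤ.+ suc p) d-1 _} _ = z<s
  positive-numerator {mkℚ ℤ.-[1+ p ] d-1 _} (*<* ())

  ι-clears : ∀ c p s → ℚ.toℚᵘ c ≃ mkℚᵘ (ℤ.+ p) s → ι (suc s) ℚ.* c ≡ ι p
  ι-clears c p s c≃ = ℚ.toℚᵘ-injective (begin-equality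
    ℚ.toℚᵘ (ι (suc s) ℚ.* c)               ≃⟨ ℚ.toℚᵘ-homo-* (ι (suc s)) c ⟩
    ℚ.toℚᵘ (ι (suc s)) ℚᵘ.* ℚ.toℚᵘ c       ≃⟨ ℚᵘ.*-cong (ιᵘ (suc s)) c≃ ⟩
    mkℚᵘ (ℤ.+ suc s) 0 ℚᵘ.* mkℚᵘ (ℤ.+ p) s ≃⟨ *≡* cross ⟩
    mkℚᵘ (ℤ.+ p) 0                       ≃⟨ ιᵘ p ⟨
    ℚ.toℚᵘ (ι p)                         ∎)
    where
    open ℚᵘ.≤-Reasoning
    cross : (ℤ.+ suc s ℤ.* ℤ.+ p) ℤ.* (ℤ.+ 1) ≡ ℤ.+ p ℤ.* (ℤ.+ suc (s + 0))
    cross = trans (ℤ.*-identityʳ _) (trans (ℤ.*-comm (ℤ.+ suc s) (ℤ.+ p))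
              (cong (λ z → ℤ.+ p ℤ.* (ℤ.+ suc z)) (sym (+-identityʳ s))))

  numerator-clears : ∀ {c} → 0ℚ ℚ.< c → ι (↧ₙ c) ℚ.* c ≡ ι ∣ ↥ c ∣
  numerator-clears {c@(mkℚ (ℤ.+ p) d-1 _)} _ = ι-clears c p d-1 ℚᵘ.≃-refl
  numerator-clears {mkℚ ℤ.-[1+ p ] d-1 _} (*<* ())

  fraction : ℕ → ℕ → ℚ
  fraction S a = ℚ.fromℚᵘ (mkℚᵘ (ℤ.+ a) (pred S))

  fraction-clears : ∀ {S} a → 0 < S → ι S ℚ.* fraction S a ≡ ι a
  fraction-clears {suc s} a _ = ι-clears _ a s (ℚ.toℚᵘ-fromℚᵘ (mkℚᵘ (ℤ.+ a) s))

  record Scaling {n} (G : WGraph n) : Set where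
    field
      S     : ℕ
      S>0   : 0 < S
      w     : Fin (length G) → ℕ
      w>0   : ∀ i → 0 < w i
      scale : ∀ i → ι S ℚ.* weight (lookup G i) ≡ ι (w i)

  *-pos : ∀ {a b} → 0 < a → 0 < b → 0 < a * b
  *-pos {suc a} {suc b} _ _ = z<s

  rescale : ∀ k {S c w} → ι S ℚ.* c ≡ ι w → ι (k * S) ℚ.* c ≡ ι (k * w)
  rescale k {S} {c} {w} e = begin
    ι (k * S) ℚ.* c   ≡⟨ cong (ℚ._* c) (ι-* k S) ⟩
    ι k ℚ.* ι S ℚ.* c     ≡⟨ ℚ.*-assoc (ι k) (ι S) c ⟩
    ι k ℚ.* (ι S ℚ.* c)   ≡⟨ cong (ι k ℚ.*_) e ⟩
    ι k ℚ.* ι w         ≡⟨ ι-* k w ⟨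
    ι (k * w)       ∎
    where open ≡-Reasoning

  scaling : ∀ {n} (G : WGraph n) → PositiveWeights G → Scaling G
  scaling [] [] = record { S = 1 ; S>0 = z<s ; w = λ () ; w>0 = λ () ; scale = λ () }
  scaling (e ∷ G) (0<c ∷ pos) = record
    { S = q * S
    ; S>0 = *-pos {q} z<s S>0
    ; w = λ { zero → S * p ; (suc i) → q * w i }
    ; w>0 = λ { zero → *-pos S>0 (positive-numerator 0<c) ; (suc i) → *-pos {q} z<s (w>0 i) }
    ; scale = λ
        { zero → subst (λ z → ι z ℚ.* weight e ≡ ι (S * p)) (*-comm S q)
                   (rescale S (numerator-clears 0<c))
        ; (suc i) → rescale q (scale i) }
    }
    where
    open Scaling (scaling G pos)
    q = ↧ₙ (weight e)
    p = ∣ ↥ (weight e) ∣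

  scaleBy : ∀ {n} {G : WGraph n} (k : ℕ) → 0 < k → Scaling G → Scaling G
  scaleBy k k>0 σ = record
    { S = k * S ; S>0 = *-pos k>0 S>0 ; w = λ i → k * w i ; w>0 = λ i → *-pos k>0 (w>0 i)
    ; scale = λ i → rescale k (scale i) }
    where open Scaling σ

  len-scale : ∀ {n} (G : WGraph n) (S : ℕ) (w : Fin (length G) → ℕ) →
              (∀ i → ι S ℚ.* weight (lookup G i) ≡ ι (w i)) →
              ∀ {u v} (p : WWalk G u v) → ι S ℚ.* len G p ≡ ι (NatLength.natLen G w p)
  len-scale G S w scale nil = trans (ℚ.*-zeroʳ (ι S)) (sym ι-zero)
  len-scale G S w scale (cons i _ p) = trans (ℚ.*-distribˡ-+ (ι S) _ _)
    (trans (cong₂ ℚ._+_ (scale i) (len-scale G S w scale p)) (sym (ι-+ (w i) _)))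

  0≤fraction : ∀ S a → 0ℚ ℚ.≤ fraction S a
  0≤fraction S a = ℚ.toℚᵘ-cancel-≤ (ℚᵘ.≤-respʳ-≃ (ℚᵘ.≃-sym (ℚ.toℚᵘ-fromℚᵘ (mkℚᵘ (ℤ.+ a) (pred S))))
    (ℚᵘ.nonNegative⁻¹ (mkℚᵘ (ℤ.+ a) (pred S))))

  module Scaled {n} (G : WGraph n) (σ : Scaling G) (conn : Connected wends G) where
    open Scaling σ
    open GraphMetric G w w>0 conn public
    open NatLength G w using (natLen)

    len≡ : ∀ {u v} (p : WWalk G u v) → ι S ℚ.* len G p ≡ ι (natLen p)
    len≡ = len-scale G S w scale

    scaledLower : ∀ {x y d} → IsDist G x y d → ι (δ x y) ℚ.≤ ι S ℚ.* d
    scaledLower ((p , refl) , _) = ℚ.≤-trans (ι-mono (δ≤ p)) (ℚ.≤-reflexive (sym (len≡ p)))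

    ιS-nonNeg : ℚ.NonNegative (ι S)
    ιS-nonNeg = ℚ.pos⇒nonNeg (ι S) {{ι-positive S>0}}

    scaledUpper : ∀ {x y d} → IsDist G x y d → ι S ℚ.* d ℚ.≤ ι (δ x y)
    scaledUpper {x} {y} {d} (_ , min) with geodesic x y
    ... | p , p≤ = ℚ.≤-trans (ℚ.*-monoˡ-≤-nonNeg (ι S) {{ιS-nonNeg}} (min p))
                     (ℚ.≤-trans (ℚ.≤-reflexive (len≡ p)) (ι-mono p≤))

    scaledDist : ∀ {x y d} → IsDist G x y d → ι S ℚ.* d ≡ ι (δ x y)
    scaledDist dist = ℚ.≤-antisym (scaledUpper dist) (scaledLower dist)

  -- Dominating trees and their stretch

  module Steiner {n} (G : WGraph n) (X : Metric n) {S : ℕ} (S>0 : 0 < S)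
                 (scaledDist : ∀ {x y d} → IsDist G x y d → ι S ℚ.* d ≡ ι (Metric.δ X x y))
                 (v₀ : Fin n) (I' : ℕ) (f : ℕ → Fin n → Fin n) where
    open Metric X
    open Journey X f
    module L = LevelledTree X v₀ I' f (fraction S)

    treeLen : ∀ {u v} (p : WWalk L.tree u v) → ι S ℚ.* len L.tree p ≡ ι (L.natLen p)
    treeLen = len-scale L.tree S L.natWeight
      λ i → trans (cong (ι S ℚ.*_) (L.weight-tree i)) (fraction-clears (L.natWeight i) S>0)

    dominatingTree : DominatingTree G
    dominatingTree = record
      { m = L.m
      ; T = L.tree
      ; isTree = L.connected , L.acyclic
      ; nonneg = Allₚ.tabulate⁺ (λ j → 0≤fraction S (L.natCost j))
      ; emb = L.emb
      ; embInj = L.emb-injective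
      ; dominating = λ { x y dG dT distG ((q , refl) , _) →
            ℚ.*-cancelˡ-≤-pos (ι S) {{ι-positive S>0}}
          (ℚ.≤-trans (ℚ.≤-reflexive (scaledDist distG)) (ℚ.≤-trans
            (ι-mono (subst₂ (λ a b → δ a b ≤ L.natLen q) (L.label-emb x) (L.label-emb y) (L.dominates q)))
            (ℚ.≤-reflexive (sym (treeLen q))))) }
      }

    -- Multiplied by `S` and `K`, all lengths become integers, and the hypothesis on Kε turns the
    -- one surplus copy of `δ x y` into `K` times ε of it.
    stretch : ∀ {K ε x y i} → 0 < K → 1ℚ ℚ.≤ ι K ℚ.* ε → i < suc I' → position i x ≡ position i y →
      K * (travel i x + travel i y) ≤ suc K * δ x y →
      ∀ dG dT → IsDist G x y dG →
      IsDist L.tree (L.emb x) (L.emb y) dT →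
      dT ℚ.≤ (1ℚ ℚ.+ ε) ℚ.* dG
    stretch {K} {ε} {x} {y} {i} K>0 1≤Kε i< meets short dG dT distG (_ , min) =
      ℚ.*-cancelˡ-≤-pos (ι S) {{ι-positive S>0}} (ℚ.*-cancelˡ-≤-pos (ι K) {{ι-positive K>0}} (begin
        ι K ℚ.* (ι S ℚ.* dT)                    ≤⟨ mono K (mono S (min (proj₁ walk))) ⟩
        ι K ℚ.* (ι S ℚ.* len L.tree (proj₁ walk))
          ≡⟨ cong (ι K ℚ.*_) (trans (treeLen (proj₁ walk)) (cong ι (proj₂ walk))) ⟩
        ι K ℚ.* ι (travel i x + travel i y) ≡⟨ ι-* K _ ⟨
        ι (K * (travel i x + travel i y)) ≤⟨ ι-mono short ⟩
        ι (suc K * δ x y)                 ≡⟨ ι-+ (δ x y) (K * δ x y) ⟩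
        ι (δ x y) ℚ.+ ι (K * δ x y)         ≡⟨ cong (λ z → ι (δ x y) ℚ.+ z) (ι-* K (δ x y)) ⟩
        ι (δ x y) ℚ.+ ι K ℚ.* ι (δ x y)         ≤⟨ ℚ.+-monoˡ-≤ (ι K ℚ.* ι (δ x y)) gain ⟩
        ι K ℚ.* (ε ℚ.* ι (δ x y)) ℚ.+ ι K ℚ.* ι (δ x y) ≡⟨ ℚ.*-distribˡ-+ (ι K) _ _ ⟨
        ι K ℚ.* (ε ℚ.* ι (δ x y) ℚ.+ ι (δ x y))
          ≡⟨ cong (ι K ℚ.*_) (trans (ℚ.+-comm (ε ℚ.* ι (δ x y)) _) (factor ε (ι (δ x y)))) ⟩
        ι K ℚ.* ((1ℚ ℚ.+ ε) ℚ.* ι (δ x y))        ≡⟨ cong (λ z → ι K ℚ.* ((1ℚ ℚ.+ ε) ℚ.* z)) (sym (scaledDist distG)) ⟩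
        ι K ℚ.* ((1ℚ ℚ.+ ε) ℚ.* (ι S ℚ.* dG))       ≡⟨ cong (ι K ℚ.*_) (swapS (1ℚ ℚ.+ ε) (ι S) dG) ⟩
        ι K ℚ.* (ι S ℚ.* ((1ℚ ℚ.+ ε) ℚ.* dG))       ∎))
      where
      open ℚ.≤-Reasoning
      walk = L.meeting-walk i< meets
      mono : ∀ a {b c} → b ℚ.≤ c → ι a ℚ.* b ℚ.≤ ι a ℚ.* c
      mono a = ℚ.*-monoˡ-≤-nonNeg (ι a) {{ℚ.nonNegative (0≤ι a)}}
      gain : ι (δ x y) ℚ.≤ ι K ℚ.* (ε ℚ.* ι (δ x y))
      gain = begin
        ι (δ x y)               ≡⟨ ℚ.*-identityˡ _ ⟨
        1ℚ ℚ.* ι (δ x y)          ≤⟨ ℚ.*-monoʳ-≤-nonNeg (ι (δ x y)) {{ℚ.nonNegative (0≤ι (δ x y))}} 1≤Kε ⟩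
        ι K ℚ.* ε ℚ.* ι (δ x y)     ≡⟨ ℚ.*-assoc (ι K) ε _ ⟩
        ι K ℚ.* (ε ℚ.* ι (δ x y))   ∎
      factor : ∀ ε a → a ℚ.+ ε ℚ.* a ≡ (1ℚ ℚ.+ ε) ℚ.* a
      factor ε a = trans (cong (ℚ._+ ε ℚ.* a) (sym (ℚ.*-identityˡ a))) (sym (ℚ.*-distribʳ-+ a 1ℚ ε))
      swapS : ∀ a b c → a ℚ.* (b ℚ.* c) ≡ b ℚ.* (a ℚ.* c)
      swapS a b c = trans (sym (ℚ.*-assoc a b c)) (trans (cong (ℚ._* c) (ℚ.*-comm a b)) (ℚ.*-assoc b a c))

  two-of-three : ∀ {A : Set} {xs : List A} {a b c} → length xs ≤ 2 → a ∈ xs → b ∈ xs → c ∈ xs →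
                 a ≡ b ⊎ a ≡ c ⊎ b ≡ c
  two-of-three {xs = _ ∷ _ ∷ _ ∷ _} (s≤s (s≤s ())) _ _ _
  two-of-three {xs = _ ∷ []} _ (here refl) (here refl) _ = inj₁ refl
  two-of-three {xs = _ ∷ _ ∷ []} _ (here refl) (here refl) _ = inj₁ refl
  two-of-three {xs = _ ∷ _ ∷ []} _ (here refl) (there _) (here refl) = inj₂ (inj₁ refl)
  two-of-three {xs = _ ∷ _ ∷ []} _ (there _) (here refl) (here refl) = inj₂ (inj₂ refl)
  two-of-three {xs = _ ∷ _ ∷ []} _ (here refl) (there (here refl)) (there (here refl)) = inj₂ (inj₂ refl)
  two-of-three {xs = _ ∷ _ ∷ []} _ (there (here refl)) (here refl) (there (here refl)) = inj₂ (inj₁ refl)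
  two-of-three {xs = _ ∷ _ ∷ []} _ (there (here refl)) (there (here refl)) _ = inj₁ refl

  -- Exact trees in width one

  -- Every vertex moves to the other vertex of its topmost bag, which lies on each shortest
  -- path leaving the part of the decomposition below that bag.
  module WidthOne {n t} {X : Metric n} (t≤1 : t ≤ 1) (D : RootedDecomposition X t) where
    open Metric X
    open RootedDecomposition D

    pair : ∀ b → length (bag b) ≤ 2
    pair b = ≤-trans (bagWidth b) (s≤s t≤1)

    AtDepth : Fin n → ℕ → Set
    AtDepth v d = ∃ λ b → dep b ≡ d × v ∈ bag b

    topmost : ∀ v → ∃ λ d → AtDepth v d × (∀ {j} → AtDepth v j → d ≤ j)
    topmost v = least (λ d → any? λ b → (dep b ≟ d) ×-dec memb? _≟ᶠ_ v (bag b)) _ (home v , refl , home∈ v)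

    height : Fin n → ℕ
    height v = proj₁ (topmost v)

    top : Fin n → Node
    top v = proj₁ (proj₁ (proj₂ (topmost v)))

    dep-top : ∀ v → dep (top v) ≡ height v
    dep-top v = proj₁ (proj₂ (proj₁ (proj₂ (topmost v))))

    top∈ : ∀ v → v ∈ bag (top v)
    top∈ v = proj₂ (proj₂ (proj₁ (proj₂ (topmost v))))

    height≤ : ∀ {v b} → v ∈ bag b → height v ≤ dep b
    height≤ {v} v∈ = proj₂ (proj₂ (topmost v)) (_ , refl , v∈)

    Lower : Fin n → Set
    Lower u = Any (λ m → height m < height u) (bag (top u))

    lower? : ∀ u → Dec (Lower u)
    lower? u = Any.any? (λ m → height m <? height u) (bag (top u))

    same-top : ∀ {u v} → height v ≤ height u → top v ⊑ top u → top v ≡ top u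
    same-top {u} {v} le p =
      ⊑-dep≡ p (≤-trans (≤-reflexive (dep-top v)) (≤-trans le (≤-reflexive (sym (dep-top u)))))

    -- The separating vertex also lies in the parent bag, whence its smaller height.
    leaving : ∀ {u v} → ¬ (top v ⊑ top u) →
              ∃ λ m → m ∈ bag (top u) × height m < height u × δ u m + δ m v ≤ δ u v
    leaving {u} {v} v⋢u with depth? (top u) | sep ⊑-refl v⋢u (top∈ u) (top∈ v)
    ... | inj₁ e | _ = ⊥-elim (v⋢u (subst (top v ⊑_) (sym e) (⊑-root (top v))))
    ... | inj₂ 0<d | m , m∈ , m∈p , le =
      m , m∈ , <-≤-trans (≤-<-trans (height≤ m∈p) (dep-par< 0<d)) (≤-reflexive (dep-top u)) , le

    ¬lower-top : ∀ {u v} → ¬ Lower u → height v ≤ height u → top v ≡ top u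
    ¬lower-top {u} {v} ¬l vu with top v ⊑? top u
    ... | yes p = same-top vu p
    ... | no v⋢u with leaving v⋢u
    ...   | m , m∈ , m<u , _ = ⊥-elim (¬l (lose m∈ m<u))

    abstract
      exit : Fin n → Fin n
      exit u with lower? u
      ... | yes l = proj₁ (find l)
      -- Here all entries of the bag are topmost in it. Sending them to its first entry makes both
      -- meet at the cost of their distance.
      ... | no _ = nth (bag (top u)) 0 u

      -- `u` and its exit fill the bag, so a separating vertex of smaller height than `u` can only
      -- be the exit.
      exit-lower : ∀ {u v} → Lower u → height v ≤ height u → u ≢ v →
                   height (exit u) < height u × δ u (exit u) + δ (exit u) v ≤ δ u v
      exit-lower {u} {v} l vu u≢v with lower? u
      ... | no ¬l = ⊥-elim (¬l l)
      ... | yes l' with find l'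
      ...   | m , m∈ , m<u with top v ⊑? top u
      ...     | yes p with two-of-three (pair (top u)) (top∈ u)
                             (subst (λ z → v ∈ bag z) (same-top vu p) (top∈ v)) m∈
      ...       | inj₁ u≡v = ⊥-elim (u≢v u≡v)
      ...       | inj₂ (inj₁ refl) = ⊥-elim (<-irrefl refl m<u)
      ...       | inj₂ (inj₂ refl) = ⊥-elim (<⇒≢ m<u (trans (sym (dep-top v))
                                       (trans (cong dep (same-top vu p)) (dep-top u))))
      exit-lower {u} {v} l vu u≢v | yes l' | m , m∈ , m<u | no v⋢u with leaving v⋢u
      ... | m' , m'∈ , m'<u , le with two-of-three (pair (top u)) (top∈ u) m∈ m'∈
      ...   | inj₁ refl = ⊥-elim (<-irrefl refl m<u)
      ...   | inj₂ (inj₁ refl) = ⊥-elim (<-irrefl refl m'<u)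
      ...   | inj₂ (inj₂ refl) = m<u , le

      exit-¬lower : ∀ {u v} → ¬ Lower u → height v ≡ height u → u ≢ v →
                    exit u ≡ exit v × δ u (exit u) + δ v (exit v) ≤ δ u v
      exit-¬lower {u} {v} ¬l vu u≢v with lower? u | lower? v | ¬lower-top ¬l (≤-reflexive vu)
      ... | yes l | _ | _ = ⊥-elim (¬l l)
      ... | no _ | yes l | e = ⊥-elim (¬l (subst₂ (λ b d → Any (λ m → height m < d) (bag b)) e vu l))
      ... | no _ | no _ | e with bag (top u) in equ | bag (top v) in eqv | top∈ u | top∈ v | pair (top u)
      ...   | as | bs | u∈ | v∈ | len with trans (sym equ) (trans (cong bag (sym e)) eqv)
      exit-¬lower {u} {v} ¬l vu u≢v | no _ | no _ | e | a ∷ as | .(a ∷ as) | u∈ | v∈ | len | refl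
        with two-of-three len u∈ v∈ (here refl)
      ... | inj₁ u≡v = ⊥-elim (u≢v u≡v)
      ... | inj₂ (inj₁ refl) = refl , ≤-reflexive (trans (cong (_+ δ v u) (δ-self u)) (δ-sym v u))
      ... | inj₂ (inj₂ refl) = refl , ≤-reflexive (trans (cong (δ u v +_) (δ-self v)) (+-identityʳ _))

    maxHeight : ∃ λ B → ∀ v → height v ≤ B
    maxHeight = upperBound height

    B : ℕ
    B = proj₁ maxHeight

    Moved : ℕ → Fin n → Fin n → Set
    Moved d u u' = (height u ≡ d × u' ≡ exit u) ⊎ (height u < d × u' ≡ u)

    abstract
      move : ℕ → Fin n → Fin n
      move d u with height u ≟ d
      ... | yes _ = exit u
      ... | no _ = u

      moved : ∀ d u → height u ≤ d → Moved d u (move d u)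
      moved d u u≤d with height u ≟ d
      ... | yes e = inj₁ (e , refl)
      ... | no u≢d = inj₂ (≤∧≢⇒< u≤d u≢d , refl)

    -- The distance still to be bridged is a potential that pays for the moves, so the total travel
    -- never exceeds the original distance.
    Round : ℕ → Fin n → Fin n → Fin n → Fin n → Set
    Round d u v u' v' = δ u u' + δ v v' + δ u' v' ≤ δ u v × (u' ≡ v' ⊎ height u' < d × height v' < d)

    Round-sym : ∀ {d u v u' v'} → Round d u v u' v' → Round d v u v' u'
    Round-sym {d} {u} {v} {u'} {v'} (le , merged) =
      subst₂ _≤_ (cong₂ _+_ (+-comm (δ u u') (δ v v')) (δ-sym u' v')) (δ-sym u v) le
      , [ (λ e → inj₁ (sym e)) , (λ (p , q) → inj₂ (q , p)) ]′ merged

    ¬lower-height : ∀ {u v} → ¬ Lower u → height v ≤ height u → height v ≡ height u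
    ¬lower-height {u} {v} ¬l le =
      trans (sym (dep-top v)) (trans (cong dep (¬lower-top ¬l le)) (dep-top u))

    round-one : ∀ {d u v} → height u ≡ d → height v < d → u ≢ v → Round d u v (exit u) v
    round-one {d} {u} {v} refl v< u≢v with lower? u
    ... | no ¬l = ⊥-elim (<⇒≢ v< (¬lower-height ¬l (<⇒≤ v<)))
    ... | yes l =
      ≤-trans (≤-reflexive (cong (_+ δ (exit u) v)
                (trans (cong (δ u (exit u) +_) (δ-self v)) (+-identityʳ _))))
              (proj₂ (exit-lower l (<⇒≤ v<) u≢v))
      , inj₂ (proj₁ (exit-lower l (<⇒≤ v<) u≢v) , v<)

    round-both : ∀ {d u v} → height u ≡ d → height v ≡ d → u ≢ v → Round d u v (exit u) (exit v)
    round-both {d} {u} {v} refl hv u≢v with lower? u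
    ... | no ¬l =
      ≤-trans (≤-reflexive (trans (cong (δ u (exit u) + δ v (exit v) +_)
                 (trans (cong (δ (exit u)) (sym (proj₁ q))) (δ-self (exit u)))) (+-identityʳ _))) (proj₂ q)
      , inj₁ (proj₁ q)
      where q = exit-¬lower ¬l hv u≢v
    ... | yes l with exit-lower l (≤-reflexive hv) u≢v
    -- The exit of `u` lies on the way to `v` and is lower, which leaves a one-sided round for `v`
    -- and that exit.
    ...   | low , le with round-one {u = v} {v = exit u} hv low (λ e → <⇒≢ low (trans (cong height (sym e)) hv))
    ...     | le' , merged = (begin
        δ u (exit u) + δ v (exit v) + δ (exit u) (exit v)    ≡⟨ rearrange (δ u (exit u)) _ _ ⟩
        δ u (exit u) + (δ v (exit v) + 0 + δ (exit u) (exit v))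
          ≡⟨ cong (δ u (exit u) +_) (cong₂ (λ a b → δ v (exit v) + a + b)
               (sym (δ-self (exit u))) (δ-sym (exit u) (exit v))) ⟩
        δ u (exit u) + (δ v (exit v) + δ (exit u) (exit u) + δ (exit v) (exit u))
          ≤⟨ +-monoʳ-≤ _ le' ⟩
        δ u (exit u) + δ v (exit u)                          ≡⟨ cong (δ u (exit u) +_) (δ-sym v (exit u)) ⟩
        δ u (exit u) + δ (exit u) v                          ≤⟨ le ⟩
        δ u v                                                ∎)
      , [ (λ e → inj₁ (sym e)) , (λ (p , q) → inj₂ (q , p)) ]′ merged
      where
      open ≤-Reasoning
      rearrange : ∀ a b c → a + b + c ≡ a + (b + 0 + c)
      rearrange = solve-∀

    round : ∀ {d u v u' v'} → Moved d u u' → Moved d v v' → u ≢ v → Round d u v u' v'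
    round (inj₁ (hu , refl)) (inj₁ (hv , refl)) u≢v = round-both hu hv u≢v
    round (inj₁ (hu , refl)) (inj₂ (hv , refl)) u≢v = round-one hu hv u≢v
    round (inj₂ (hu , refl)) (inj₁ (hv , refl)) u≢v = Round-sym (round-one hv hu (λ e → u≢v (sym e)))
    round {u = u} {v} (inj₂ (hu , refl)) (inj₂ (hv , refl)) u≢v =
      ≤-reflexive (cong₂ _+_ (cong₂ _+_ (δ-self u) (δ-self v)) refl) , inj₂ (hu , hv)

    -- The deepest vertices move first, one height per level.
    open Journey X (λ i → move (B ∸ i))

    Meets : Fin n → Fin n → Set
    Meets x y = ∃ λ i → i ≤ suc B × position i x ≡ position i y × travel i x + travel i y ≤ δ x y

    meets : ∀ x y → Meets x y
    meets x y = go B 0 (+-identityʳ B) (proj₂ maxHeight x) (proj₂ maxHeight y) ≤-refl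
      where
      go : ∀ d i → d + i ≡ B → height (position i x) ≤ d → height (position i y) ≤ d →
           travel i x + travel i y + δ (position i x) (position i y) ≤ δ x y → Meets x y
      go d i d+i≡B hx hy le with position i x ≟ᶠ position i y
      ... | yes e = i , ≤-trans (m≤n+m i d) (≤-trans (≤-reflexive d+i≡B) (n≤1+n B)) , e , ≤-trans (m≤m+n _ _) le
      ... | no x≢y = next d d+i≡B rounded
        where
        B∸i≡d : B ∸ i ≡ d
        B∸i≡d = trans (cong (_∸ i) (sym d+i≡B)) (m+n∸n≡m d i)
        moved-at : ∀ z → height (position i z) ≤ d → Moved d (position i z) (position (suc i) z)
        moved-at z hz = subst (λ e → Moved d (position i z) (move e (position i z))) (sym B∸i≡d) (moved d _ hz)
        Rounded : ℕ → Set
        Rounded d = Round d (position i x) (position i y) (position (suc i) x) (position (suc i) y)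
        rounded : Rounded d
        rounded = round (moved-at x hx) (moved-at y hy) x≢y
        spent : travel (suc i) x + travel (suc i) y + δ (position (suc i) x) (position (suc i) y) ≤ δ x y
        spent = ≤-trans (≤-reflexive (rearrange (travel i x) (δ (position i x) (position (suc i) x)) (travel i y)
                    (δ (position i y) (position (suc i) y)) (δ (position (suc i) x) (position (suc i) y))))
                  (≤-trans (+-monoʳ-≤ (travel i x + travel i y) (proj₁ rounded)) le)
          where
          rearrange : ∀ a b c d e → a + b + (c + d) + e ≡ a + c + (b + d + e)
          rearrange = solve-∀
        next : ∀ d → d + i ≡ B → Rounded d → Meets x y
        next d d+i≡B (_ , inj₁ e) =
          suc i , s≤s (≤-trans (m≤n+m i d) (≤-reflexive d+i≡B)) , e , ≤-trans (m≤m+n _ _) spent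
        next (suc d) d+i≡B (_ , inj₂ (hx' , hy')) =
          go d (suc i) (trans (+-suc d i) d+i≡B) (≤-pred hx') (≤-pred hy') spent

  -- All scales

  Family : ∀ {n} → Metric n → ℕ → ℕ → List (ℕ → Fin n → Fin n) → Set
  Family X K I fs = ∀ x y → x ≢ y → ∃ λ f → f ∈ fs × ∃ λ i → i ≤ I ×
    Journey.position X f i x ≡ Journey.position X f i y ×
    K * (Journey.travel X f i x + Journey.travel X f i y) ≤ suc K * Metric.δ X x y

  diameter : ∀ {n} (X : Metric n) → ∃ λ B → ∀ x y → Metric.δ X x y ≤ B
  diameter X = let open Metric X
                   B , row≤B = upperBound (λ x → proj₁ (upperBound (δ x)))
               in B , λ x y → ≤-trans (proj₂ (upperBound (δ x)) y) (row≤B x)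

  power-above : ∀ {ρ} → 2 ≤ ρ → ∀ m → m < ρ ^ m
  power-above 2≤ρ zero = z<s
  power-above {ρ} 2≤ρ (suc m) = begin-strict
    suc m             ≤⟨ power-above 2≤ρ m ⟩
    ρ ^ m             <⟨ m<m+n (ρ ^ m) (≤-trans z<s (power-above 2≤ρ m)) ⟩
    ρ ^ m + ρ ^ m     ≡⟨ cong (ρ ^ m +_) (sym (+-identityʳ (ρ ^ m))) ⟩
    2 * ρ ^ m         ≤⟨ *-monoˡ-≤ (ρ ^ m) 2≤ρ ⟩
    ρ ^ suc m         ∎
    where open ≤-Reasoning

  bracket : ∀ {ρ d v} → 2 ≤ ρ → 0 < d → d ≤ v →
            ∃ λ m → m ≤ v × d * ρ ^ m ≤ v × v < d * ρ ^ suc m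
  bracket {ρ} {d} {v} 2≤ρ 0<d d≤v with least (λ m → v <? d * ρ ^ suc m) v v<
    where
    v< : v < d * ρ ^ suc v
    v< = ≤-trans (≤-trans (s≤s (n≤1+n v)) (power-above 2≤ρ (suc v)))
                 (≤-trans (≤-reflexive (sym (*-identityˡ _))) (*-monoˡ-≤ (ρ ^ suc v) 0<d))
  ... | zero , up , _ = zero , z≤n , ≤-trans (≤-reflexive (*-identityʳ d)) d≤v , up
  ... | suc m , up , min = suc m , m≤v , low , up
    where
    low : d * ρ ^ suc m ≤ v
    low = ≮⇒≥ λ lt → 1+n≰n (min lt)
    m≤v : suc m ≤ v
    m≤v = ≤-trans (<⇒≤ (power-above 2≤ρ (suc m)))
            (≤-trans (≤-reflexive (sym (*-identityˡ _))) (≤-trans (*-monoˡ-≤ (ρ ^ suc m) 0<d) low))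

  even-or-odd-power : ∀ ρ m → ∃ λ i → i ≤ m × (ρ ^ m ≡ 1 * (ρ * ρ) ^ i ⊎ ρ ^ m ≡ ρ * (ρ * ρ) ^ i)
  even-or-odd-power ρ zero = 0 , z≤n , inj₁ refl
  even-or-odd-power ρ (suc m) with even-or-odd-power ρ m
  ... | i , i≤m , inj₁ e = i , m≤n⇒m≤1+n i≤m , inj₂ (cong (ρ *_) (trans e (*-identityˡ _)))
  ... | i , i≤m , inj₂ e = suc i , s≤s i≤m ,
    inj₁ (trans (cong (ρ *_) e) (trans (sym (*-assoc ρ ρ _)) (sym (*-identityˡ _))))

  -- A scale φ handles distances from dφ to dρφ. `16K≤d` makes the additive error a 1/K fraction of
  -- them, `dρ≤2N` puts them within reach of a hub, and `2N+15≤ρρ` lets the next scale absorb all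
  -- earlier travel.
  module MultiScale {n t} {X : Metric n} (D : RootedDecomposition X t) (K d ρ N h M : ℕ)
    (h≡ : reachBound N ≡ h) (M≡ : (2 + t) ^ suc h ≡ M) (0<d : 0 < d) (2≤ρ : 2 ≤ ρ) (16K≤d : 16 * K ≤ d)
    (dρ≤2N : d * ρ ≤ 2 * N) (2N+15≤ρρ : 15 + 2 * N ≤ ρ * ρ)
    (separated : ∀ x y → x ≢ y → d ≤ Metric.δ X x y) where
    open Metric X

    -- A crude count of levels: the exponent found by `bracket` is at most the distance itself. It
    -- affects the depth of the trees, not their number.
    I : ℕ
    I = suc (proj₁ (diameter X))

    -- The scales of one tree grow by ρ², so that the lower levels displace a vertex by at most φ; two
    -- interleaved sequences of scales together reach every distance.
    base : Fin 2 → ℕ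
    base zero = 1
    base (suc _) = ρ

    φ : Fin 2 → ℕ → ℕ
    φ κ i = base κ * (ρ * ρ) ^ i

    φ-suc : ∀ κ i → φ κ (suc i) ≡ ρ * ρ * φ κ i
    φ-suc κ i = lem (base κ) (ρ * ρ) ((ρ * ρ) ^ i)
      where
      lem : ∀ a b c → a * (b * c) ≡ b * (a * c)
      lem = solve-∀

    maps : Fin 2 → ℕ → ℕ → ℕ → Fin n → Fin n
    maps κ a j i = OneScale.step D (φ κ i) N h h≡ a j

    module _ (κ : Fin 2) (a j : ℕ) where
      open Journey X (maps κ a j)

      travel≤ : ∀ i x → travel i x ≤ φ κ i
      travel≤ zero x = z≤n
      travel≤ (suc i) x = begin
        travel i x + δ (position i x) (position (suc i) x)
          ≤⟨ +-mono-≤ (travel≤ i x) (OneScale.step-short D (φ κ i) N h h≡ a j (position i x)) ⟩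
        φ κ i + (2 * N + 14) * φ κ i      ≡⟨ lem N (φ κ i) ⟩
        (15 + 2 * N) * φ κ i              ≤⟨ *-monoˡ-≤ (φ κ i) 2N+15≤ρρ ⟩
        ρ * ρ * φ κ i                     ≡⟨ sym (φ-suc κ i) ⟩
        φ κ (suc i)                       ∎
        where
        open ≤-Reasoning
        lem : ∀ N p → p + (2 * N + 14) * p ≡ (15 + 2 * N) * p
        lem = solve-∀

      displacement : ∀ i x → δ x (position i x) ≤ travel i x
      displacement zero x = ≤-reflexive (δ-self x)
      displacement (suc i) x = ≤-trans (δ-tri x (position i x) (position (suc i) x))
        (+-monoˡ-≤ (δ (position i x) (position (suc i) x)) (displacement i x))

      near-start : ∀ i x → δ x (position i x) ≤ φ κ i
      near-start i x = ≤-trans (displacement i x) (travel≤ i x)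

      travel-to : ∀ i x e → position (suc i) x ≡ e → travel (suc i) x ≤ 2 * φ κ i + δ x e
      travel-to i x e refl = begin
        travel i x + δ (position i x) e                 ≤⟨ +-mono-≤ (travel≤ i x) (δ-tri (position i x) x e) ⟩
        φ κ i + (δ (position i x) x + δ x e)            ≤⟨ +-monoʳ-≤ (φ κ i) (+-monoˡ-≤ (δ x e) back) ⟩
        φ κ i + (φ κ i + δ x e)                         ≡⟨ lem (φ κ i) (δ x e) ⟩
        2 * φ κ i + δ x e                               ∎
        where
        open ≤-Reasoning
        back : δ (position i x) x ≤ φ κ i
        back = ≤-trans (≤-reflexive (δ-sym (position i x) x)) (near-start i x)
        lem : ∀ p q → p + (p + q) ≡ 2 * p + q
        lem = solve-∀

    in-range : ∀ κ i x y → δ x y ≤ d * ρ * φ κ i → δ x y ≤ N * (φ κ i + φ κ i)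
    in-range κ i x y high = begin
      δ x y                  ≤⟨ high ⟩
      d * ρ * φ κ i          ≤⟨ *-monoˡ-≤ (φ κ i) dρ≤2N ⟩
      2 * N * φ κ i          ≡⟨ lem N (φ κ i) ⟩
      N * (φ κ i + φ κ i)    ∎
      where
      open ≤-Reasoning
      lem : ∀ N p → 2 * N * p ≡ N * (p + p)
      lem = solve-∀

    MeetsAt : Fin 2 → ℕ → Fin n → Fin n → Set
    MeetsAt κ i x y = ∃ λ a → a < M × ∃ λ j → j < suc t × (let open Journey X (maps κ a j) in
      position (suc i) x ≡ position (suc i) y × K * (travel (suc i) x + travel (suc i) y) ≤ suc K * δ x y)

    -- The 16 is 4 + 12: each end pays φ for the earlier levels and φ for having drifted, and the
    -- hub costs 12φ.
    meets-at : ∀ κ i x y → d * φ κ i ≤ δ x y → OneScale.Linked D (φ κ i) N h h≡ x y → MeetsAt κ i x y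
    meets-at κ i x y low (a , a< , j , j< , e , excess , joins) =
      a , ≤-trans a< (≤-reflexive M≡) , j , j< , trans to-x (sym to-y) , (begin
        K * (travel (suc i) x + travel (suc i) y)
          ≤⟨ *-monoʳ-≤ K (+-mono-≤ (travel-to κ a j i x e to-x) (travel-to κ a j i y e to-y)) ⟩
        K * ((2 * φ κ i + δ x e) + (2 * φ κ i + δ y e))
          ≡⟨ cong (λ z → K * ((2 * φ κ i + δ x e) + (2 * φ κ i + z))) (δ-sym y e) ⟩
        K * ((2 * φ κ i + δ x e) + (2 * φ κ i + δ e y))
          ≡⟨ cong (K *_) (lem₁ (φ κ i) (δ x e) (δ e y)) ⟩
        K * (4 * φ κ i + (δ x e + δ e y))
          ≤⟨ *-monoʳ-≤ K (+-monoʳ-≤ (4 * φ κ i) excess) ⟩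
        K * (4 * φ κ i + (δ x y + 12 * φ κ i))
          ≡⟨ lem₂ K (φ κ i) (δ x y) ⟩
        16 * K * φ κ i + K * δ x y
          ≤⟨ +-monoˡ-≤ (K * δ x y) (≤-trans (*-monoˡ-≤ (φ κ i) 16K≤d) low) ⟩
        suc K * δ x y ∎)
      where
      open Journey X (maps κ a j)
      open ≤-Reasoning
      to-x : position (suc i) x ≡ e
      to-x = joins (position i x) (inj₁ (near-start κ a j i x))
      to-y : position (suc i) y ≡ e
      to-y = joins (position i y) (inj₂ (near-start κ a j i y))
      lem₁ : ∀ p a b → (2 * p + a) + (2 * p + b) ≡ 4 * p + (a + b)
      lem₁ = solve-∀
      lem₂ : ∀ K p b → K * (4 * p + (b + 12 * p)) ≡ 16 * K * p + K * b
      lem₂ = solve-∀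

    scale-of : ∀ x y → x ≢ y → ∃₂ λ κ i → suc i ≤ I × d * φ κ i ≤ δ x y × δ x y ≤ d * ρ * φ κ i
    scale-of x y x≢y with bracket 2≤ρ 0<d (separated x y x≢y)
    ... | m , m≤ , low , high with even-or-odd-power ρ m
    ...   | i , i≤m , e = κ e , i , s≤s (≤-trans i≤m (≤-trans m≤ (proj₂ (diameter X) x y)))
                        , subst (λ z → d * z ≤ δ x y) (κ-φ e) low
                        , subst (λ z → δ x y ≤ d * ρ * z) (κ-φ e)
                            (≤-trans (<⇒≤ high) (≤-reflexive (sym (*-assoc d ρ (ρ ^ m)))))
      where
      Parity = ρ ^ m ≡ 1 * (ρ * ρ) ^ i ⊎ ρ ^ m ≡ ρ * (ρ * ρ) ^ i
      κ : Parity → Fin 2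
      κ (inj₁ _) = zero
      κ (inj₂ _) = suc zero
      κ-φ : ∀ e → ρ ^ m ≡ φ (κ e) i
      κ-φ (inj₁ e) = e
      κ-φ (inj₂ e) = e

    size : ℕ
    size = 2 * (M * suc t)

    member : Fin size → ℕ → Fin n → Fin n
    member z = let κ , r = remQuot {2} (M * suc t) z
                   a , j = remQuot {M} (suc t) r
               in maps κ (toℕ a) (toℕ j)

    family : List (ℕ → Fin n → Fin n)
    family = tabulate member

    family-length : length family ≡ size
    family-length = length-tabulate member

    maps∈ : ∀ κ {a j} → a < M → j < suc t → maps κ a j ∈ family
    maps∈ κ {a} {j} a< j< = subst (_∈ family) eq (∈-tabulate⁺ {f = member} z)
      where
      r : Fin (M * suc t)
      r = combine (fromℕ< a<) (fromℕ< j<)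
      z : Fin size
      z = combine κ r
      at : Fin 2 × Fin (M * suc t) → ℕ → Fin n → Fin n
      at (κ , r) = let a , j = remQuot {M} (suc t) r in maps κ (toℕ a) (toℕ j)
      at′ : Fin M × Fin (suc t) → ℕ → Fin n → Fin n
      at′ (a , j) = maps κ (toℕ a) (toℕ j)
      eq : member z ≡ maps κ a j
      eq = trans (cong at (remQuot-combine {2} κ r))
        (trans (cong at′ (remQuot-combine {M} (fromℕ< a<) (fromℕ< j<)))
               (cong₂ (maps κ) (toℕ-fromℕ< a<) (toℕ-fromℕ< j<)))

    assemble : ∀ {κ i x y} → suc i ≤ I → MeetsAt κ i x y →
               ∃ λ f → f ∈ family × ∃ λ i → i ≤ I ×
               Journey.position X f i x ≡ Journey.position X f i y ×
               K * (Journey.travel X f i x + Journey.travel X f i y) ≤ suc K * δ x y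
    assemble {κ} {i} i<I (a , a< , j , j< , meets , short) =
      maps κ a j , maps∈ κ a< j< , suc i , i<I , meets , short

    covers : Family X K I family
    covers x y x≢y =
      let κ , i , i<I , low , high = scale-of x y x≢y
      in assemble {κ} {i} i<I (meets-at κ i x y low
           (OneScale.step-joins D (φ κ i) N h h≡ x y (in-range κ i x y high)))

  -- Choice of the precision, size bound and final covers

  proper-fraction : ∀ {ε} → 0ℚ ℚ.< ε → ε ℚ.< 1ℚ → ∣ ↥ ε ∣ < ↧ₙ ε
  proper-fraction {mkℚ (ℤ.+ p) d-1 _} _ (*<* lt)
    with subst₂ ℤ._<_ (ℤ.*-identityʳ (ℤ.+ p)) (ℤ.*-identityˡ (ℤ.+ suc d-1)) lt
  ... | +<+ p<q = p<q
  proper-fraction {mkℚ -[1+ p ] d-1 _} (*<* ()) _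

  reciprocal-bound : ∀ {ε K} → 0ℚ ℚ.< ε → ↧ₙ ε ≤ K * ∣ ↥ ε ∣ → 1ℚ ℚ.≤ ι K ℚ.* ε
  reciprocal-bound {ε} {K} 0<ε q≤Kp = ℚ.*-cancelˡ-≤-pos (ι q) {{ι-positive {q} z<s}} (begin
    ι q ℚ.* 1ℚ             ≡⟨ ℚ.*-identityʳ (ι q) ⟩
    ι q                    ≤⟨ ι-mono q≤Kp ⟩
    ι (K * ∣ ↥ ε ∣)        ≡⟨ ι-* K ∣ ↥ ε ∣ ⟩
    ι K ℚ.* ι ∣ ↥ ε ∣      ≡⟨ cong (ι K ℚ.*_) (numerator-clears 0<ε) ⟨
    ι K ℚ.* (ι q ℚ.* ε)    ≡⟨ ℚ.*-assoc (ι K) (ι q) ε ⟨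
    ι K ℚ.* ι q ℚ.* ε      ≡⟨ cong (ℚ._* ε) (ℚ.*-comm (ι K) (ι q)) ⟩
    ι q ℚ.* ι K ℚ.* ε      ≡⟨ ℚ.*-assoc (ι q) (ι K) ε ⟩
    ι q ℚ.* (ι K ℚ.* ε)    ∎)
    where
    open ℚ.≤-Reasoning
    q = ↧ₙ ε

  module Covering {n} (G : WGraph (suc n)) (X : Metric (suc n)) {S : ℕ} (S>0 : 0 < S)
                  (scaledDist : ∀ {x y d} → IsDist G x y d → ι S ℚ.* d ≡ ι (Metric.δ X x y)) where

    tree-of : ℕ → (ℕ → Fin (suc n) → Fin (suc n)) → DominatingTree G
    tree-of I f = Steiner.dominatingTree G X S>0 scaledDist zero I f

    treeCover : ∀ {K I ε fs} → 0 < K → 1ℚ ℚ.≤ ι K ℚ.* ε → Family X K I fs →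
                IsTreeCover G ε (map (tree-of I) fs)
    treeCover {K} {I} {ε} K>0 1≤Kε family x y x≢y with family x y x≢y
    ... | f , f∈ , i , i≤I , meets , short = tree-of I f , ∈-map⁺ (tree-of I) f∈ ,
      Steiner.stretch G X S>0 scaledDist zero I f {K} {ε} K>0 1≤Kε (s≤s i≤I) meets short

  widthOne-family : ∀ {n t} {X : Metric n} → t ≤ 1 → RootedDecomposition X t → ∀ K →
                    ∃₂ λ I f → Family X K I (f ∷ [])
  widthOne-family t≤1 D K = suc B , _ , λ x y _ →
    let i , i≤ , meet , short = meets x y
    in _ , here refl , i , i≤ , meet , ≤-trans (*-monoʳ-≤ K short) (m≤n+m _ _)
    where open WidthOne t≤1 D

  one-tree : ∀ {ℓ} e b → ℓ ≤ 1 → ℓ ^ e ≤ 2 ^ b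
  one-tree {ℓ} e b ℓ≤1 = ≤-trans (^-monoˡ-≤ e ℓ≤1) (≤-trans (≤-reflexive (^-zeroˡ e)) (m^n>0 2 b))

  ^-distrib-* : ∀ k a b → (a * b) ^ k ≡ a ^ k * b ^ k
  ^-distrib-* zero a b = refl
  ^-distrib-* (suc k) a b = trans (cong (a * b *_) (^-distrib-* k a b))
    ([m*n]*[o*p]≡[m*o]*[n*p] a b (a ^ k) (b ^ k))

  2+t≤2^t : ∀ {t} → 2 ≤ t → 2 + t ≤ 2 ^ t
  2+t≤2^t {suc zero} (s≤s ())
  2+t≤2^t {suc (suc zero)} _ = ≤-refl
  2+t≤2^t {suc (suc (suc t))} _ = begin
    suc (2 + (2 + t))        ≤⟨ s≤s (2+t≤2^t {suc (suc t)} (s≤s (s≤s z≤n))) ⟩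
    1 + 2 ^ (2 + t)          ≤⟨ +-monoˡ-≤ (2 ^ (2 + t)) (m^n>0 2 (2 + t)) ⟩
    2 ^ (2 + t) + 2 ^ (2 + t) ≡⟨ cong (2 ^ (2 + t) +_) (sym (+-identityʳ (2 ^ (2 + t)))) ⟩
    2 ^ (3 + t)              ∎
    where open ≤-Reasoning

  hops-linear : ∀ N → hops N ≡ 1 + 2 * N
  hops-linear zero = refl
  hops-linear (suc N) = trans (cong (2 +_) (hops-linear N)) (lem N)
    where
    lem : ∀ N → 3 + 2 * N ≡ 1 + 2 * suc N
    lem = solve-∀

  reachBound-linear : ∀ N → reachBound N ≡ 4 * N + 7
  reachBound-linear N = trans (cong (λ H → suc (suc (suc H + H) + 1) + 1) (hops-linear N)) (lem N)
    where
    lem : ∀ N → suc (suc (suc (1 + 2 * N) + (1 + 2 * N)) + 1) + 1 ≡ 4 * N + 7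
    lem = solve-∀

  -- The factors 2 for parity and t + 1 for positions are absorbed as two more powers of 2 + t. The
  -- exponent is then at most 2048 t K², and 2048 is the eleventh power of 2, hence at most that of
  -- `t`; this gives the 12.
  family-size : ∀ {t K h} → 2 ≤ t → 0 < K → h ≡ 4 * (16 * K * (16 * K)) + 7 →
                2 * ((2 + t) ^ suc h * suc t) ≤ 2 ^ ((t * K) ^ 12)
  family-size {t} {K} {h} 2≤t K>0 h≡ = begin
    2 * ((2 + t) ^ suc h * suc t)
      ≤⟨ *-mono-≤ (m≤m+n 2 t) (*-monoʳ-≤ ((2 + t) ^ suc h) (n≤1+n (suc t))) ⟩
    (2 + t) * ((2 + t) ^ suc h * (2 + t))   ≡⟨ cong ((2 + t) *_) (*-comm ((2 + t) ^ suc h) (2 + t)) ⟩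
    (2 + t) ^ (3 + h)                       ≤⟨ ^-monoˡ-≤ (3 + h) (2+t≤2^t 2≤t) ⟩
    (2 ^ t) ^ (3 + h)                       ≡⟨ ^-*-assoc 2 t (3 + h) ⟩
    2 ^ (t * (3 + h))                       ≤⟨ ^-monoʳ-≤ 2 exponent ⟩
    2 ^ ((t * K) ^ 12)                      ∎
    where
    open ≤-Reasoning
    exponent : t * (3 + h) ≤ (t * K) ^ 12
    exponent = begin
      t * (3 + h)                       ≡⟨ cong (λ z → t * (3 + z)) h≡ ⟩
      t * (3 + (4 * (16 * K * (16 * K)) + 7)) ≡⟨ cong (t *_) (lem K) ⟩
      t * (10 + 1024 * (K * K))         ≤⟨ *-monoʳ-≤ t (+-monoˡ-≤ (1024 * (K * K)) 10≤) ⟩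
      t * (1024 * (K * K) + 1024 * (K * K)) ≡⟨ cong (t *_) (lem₂ (K * K)) ⟩
      t * (2 ^ 11 * (K * K))            ≤⟨ *-monoʳ-≤ t (*-mono-≤ (^-monoˡ-≤ 11 2≤t) KK≤) ⟩
      t * (t ^ 11 * K ^ 12)             ≡⟨ *-assoc t (t ^ 11) (K ^ 12) ⟨
      t ^ 12 * K ^ 12                   ≡⟨ ^-distrib-* 12 t K ⟨
      (t * K) ^ 12                      ∎
      where
      lem : ∀ K → 3 + (4 * (16 * K * (16 * K)) + 7) ≡ 10 + 1024 * (K * K)
      lem = solve-∀
      lem₂ : ∀ a → 1024 * a + 1024 * a ≡ 2048 * a
      lem₂ = solve-∀
      1≤KK : 1 ≤ K * K
      1≤KK = *-mono-≤ K>0 K>0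
      10≤ : 10 ≤ 1024 * (K * K)
      10≤ = ≤-trans (m≤m+n 10 1014) (*-monoʳ-≤ 1024 1≤KK)
      KK≤ : K * K ≤ K ^ 12
      KK≤ = ≤-trans (≤-reflexive (cong (K *_) (sym (*-identityʳ K))))
              (^-monoʳ-≤ K {{>-nonZero K>0}} {2} {12} (s≤s (s≤s z≤n)))

  -- For ε = p / q this is (t K) ^ 12 ≤ (t / ε) ^ 24 ≤ (t / ε) ^ (12 t), where t ≥ 2 is essential.
  size-bound : ∀ {ℓ t K p q} → 2 ≤ t → p ≤ q → K * p ≤ t * q → ℓ ≤ 2 ^ ((t * K) ^ 12) →
               ℓ ^ (p ^ (12 * t)) ≤ 2 ^ ((t * q) ^ (12 * t))
  size-bound {ℓ} {t} {K} {p} {q} 2≤t p≤q Kp≤tq ℓ≤ = begin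
    ℓ ^ (p ^ (12 * t))                       ≤⟨ ^-monoˡ-≤ (p ^ (12 * t)) ℓ≤ ⟩
    (2 ^ ((t * K) ^ 12)) ^ (p ^ (12 * t))    ≡⟨ ^-*-assoc 2 ((t * K) ^ 12) (p ^ (12 * t)) ⟩
    2 ^ ((t * K) ^ 12 * p ^ (12 * t))        ≤⟨ ^-monoʳ-≤ 2 exponent ⟩
    2 ^ ((t * q) ^ (12 * t))                 ∎
    where
    open ≤-Reasoning
    r = 12 * t ∸ 24
    split : 12 * t ≡ 24 + r
    split = sym (m+[n∸m]≡n (*-monoʳ-≤ 12 2≤t))
    p≤tq : p ≤ t * q
    p≤tq = ≤-trans p≤q (≤-trans (≤-reflexive (sym (*-identityˡ q))) (*-monoˡ-≤ q (≤-trans (s≤s z≤n) 2≤t)))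
    square : ∀ a → a ^ 24 ≡ (a * a) ^ 12
    square a = trans (sym (^-*-assoc a 2 12)) (cong (_^ 12) (cong (a *_) (*-identityʳ a)))
    core : (t * K) * (p * p) ≤ (t * q) * (t * q)
    core = begin
      (t * K) * (p * p)   ≡⟨ lem t K p ⟩
      (t * p) * (K * p)   ≤⟨ *-mono-≤ (*-monoʳ-≤ t p≤q) Kp≤tq ⟩
      (t * q) * (t * q)   ∎
      where
      lem : ∀ t K p → (t * K) * (p * p) ≡ (t * p) * (K * p)
      lem = solve-∀
    exponent : (t * K) ^ 12 * p ^ (12 * t) ≤ (t * q) ^ (12 * t)
    exponent = begin
      (t * K) ^ 12 * p ^ (12 * t)           ≡⟨ cong (λ z → (t * K) ^ 12 * p ^ z) split ⟩
      (t * K) ^ 12 * p ^ (24 + r)           ≡⟨ cong ((t * K) ^ 12 *_) (^-distribˡ-+-* p 24 r) ⟩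
      (t * K) ^ 12 * (p ^ 24 * p ^ r)       ≡⟨ *-assoc ((t * K) ^ 12) (p ^ 24) (p ^ r) ⟨
      (t * K) ^ 12 * p ^ 24 * p ^ r         ≡⟨ cong (λ z → (t * K) ^ 12 * z * p ^ r) (square p) ⟩
      (t * K) ^ 12 * (p * p) ^ 12 * p ^ r   ≡⟨ cong (_* p ^ r) (sym (^-distrib-* 12 (t * K) (p * p))) ⟩
      ((t * K) * (p * p)) ^ 12 * p ^ r      ≤⟨ *-mono-≤ (^-monoˡ-≤ 12 core) (^-monoˡ-≤ r p≤tq) ⟩
      ((t * q) * (t * q)) ^ 12 * (t * q) ^ r ≡⟨ cong (_* (t * q) ^ r) (sym (square (t * q))) ⟩
      (t * q) ^ 24 * (t * q) ^ r            ≡⟨ ^-distribˡ-+-* (t * q) 24 r ⟨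
      (t * q) ^ (24 + r)                    ≡⟨ cong ((t * q) ^_) (sym split) ⟩
      (t * q) ^ (12 * t)                    ∎

  -- A link may be as long as dρφ while scales in one tree grow by ρ², which forces ρ to exceed `d`.
  -- The choice ρ = 2d leaves room for the additive 15 and yields N = d², the quadratic dependence
  -- on 1/ε.
  multiScale-family : ∀ {n t} {X : Metric n} {K d N h M} → d ≡ 16 * K → N ≡ d * d → reachBound N ≡ h →
    (2 + t) ^ suc h ≡ M → 2 ≤ t → 0 < K → RootedDecomposition X t →
    (∀ x y → x ≢ y → d ≤ Metric.δ X x y) →
    ∃₂ λ I fs → Family X K I fs × length fs ≤ 2 ^ ((t * K) ^ 12)
  multiScale-family {t = t} {K = K} {d} {N} {h} {M} d≡ N≡ h≡ M≡ 2≤t K>0 D separated = I , family , covers , (begin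
    length family                  ≡⟨ family-length ⟩
    2 * (M * suc t)                ≡⟨ cong (λ z → 2 * (z * suc t)) (sym M≡) ⟩
    2 * ((2 + t) ^ suc h * suc t)  ≤⟨ family-size {t} {K} {h} 2≤t K>0 h-value ⟩
    2 ^ ((t * K) ^ 12)             ∎)
    where
    open ≤-Reasoning
    16≤d : 16 ≤ d
    16≤d = ≤-trans (*-monoʳ-≤ 16 K>0) (≤-reflexive (sym d≡))
    0<d : 0 < d
    0<d = ≤-trans (s≤s z≤n) 16≤d
    h-value : h ≡ 4 * (16 * K * (16 * K)) + 7
    h-value = trans (sym h≡) (trans (reachBound-linear N)
      (cong (λ z → 4 * z + 7) (trans N≡ (cong₂ _*_ d≡ d≡))))
    dρ≤2N : d * (2 * d) ≤ 2 * N
    dρ≤2N = ≤-reflexive (trans (lem d) (cong (2 *_) (sym N≡)))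
      where
      lem : ∀ d → d * (2 * d) ≡ 2 * (d * d)
      lem = solve-∀
    2N+15≤ρρ : 15 + 2 * N ≤ 2 * d * (2 * d)
    2N+15≤ρρ = begin
      15 + 2 * N                   ≡⟨ cong (λ z → 15 + 2 * z) N≡ ⟩
      15 + 2 * (d * d)             ≤⟨ +-monoˡ-≤ (2 * (d * d)) 15≤2dd ⟩
      2 * (d * d) + 2 * (d * d)    ≡⟨ lem d ⟩
      2 * d * (2 * d)              ∎
      where
      15≤2dd : 15 ≤ 2 * (d * d)
      15≤2dd = ≤-trans (m≤m+n 15 1) (≤-trans (*-mono-≤ 16≤d 0<d) (m≤n*m (d * d) 2))
      lem : ∀ d → 2 * (d * d) + 2 * (d * d) ≡ 2 * d * (2 * d)
      lem = solve-∀
    open MultiScale D K d (2 * d) N h M h≡ M≡ 0<d (*-monoʳ-≤ 2 0<d) (≤-reflexive (sym d≡))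
      dρ≤2N 2N+15≤ρρ separated

  -- One more than the integer part of q/p exceeds q/p by at most 1, and p < q bounds the product
  -- with `p` by 2q.
  ceiling : ∀ p q → 0 < p → p < q → ∃ λ K → 0 < K × q ≤ K * p × (∀ t → 2 ≤ t → K * p ≤ t * q)
  ceiling p@(suc _) q _ p<q = suc (q / p) , z<s , q≤ , λ t 2≤t →
    ≤-trans (+-mono-≤ (<⇒≤ p<q) (m/n*n≤m q p)) (≤-trans (+-monoʳ-≤ q (m≤m+n q 0)) (*-monoˡ-≤ q 2≤t))
    where
    q≤ : q ≤ suc (q / p) * p
    q≤ = ≤-trans (≤-reflexive (m≡m%n+[m/n]*n q p)) (+-monoˡ-≤ (q / p * p) (<⇒≤ (m%n<n q p)))

  -- With ε = p/q in lowest terms, the bound by 2 to the power (t/ε)^(12t) is raised to the power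
  -- p^(12t), so that both sides are natural numbers.
  Covered : ∀ {n} → ℕ → WGraph n → ℚ → Set
  Covered t G ε = Σ (List (DominatingTree G)) λ cover → IsTreeCover G ε cover ×
    length cover ^ (∣ ↥ ε ∣ ^ (12 * t)) ≤ 2 ^ ((t * ↧ₙ ε) ^ (12 * t))

  narrow-cover : ∀ {n t} (G : WGraph (suc n)) → PositiveWeights G → Connected wends G →
                 TreeDecomposition G t → ∀ {ε} → 0ℚ ℚ.< ε → t ≤ 1 → Covered t G ε
  narrow-cover {t = t} G pos conn TD {ε} 0<ε t≤1 =
    build (widthOne-family t≤1 (Decomposed.rooted TD) (↧ₙ ε))
    where
    open Scaled G (scaling G pos) conn using (metric; scaledDist; module Decomposed)
    open Covering G metric (Scaling.S>0 (scaling G pos)) scaledDist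
    -- The tree is exact, so any `K` with Kε ≥ 1 serves; the denominator is the simplest.
    1≤qε : 1ℚ ℚ.≤ ι (↧ₙ ε) ℚ.* ε
    1≤qε = reciprocal-bound {ε} {↧ₙ ε} 0<ε
      (≤-trans (≤-reflexive (sym (*-identityʳ (↧ₙ ε)))) (*-monoʳ-≤ (↧ₙ ε) (positive-numerator 0<ε)))
    build : (∃₂ λ I f → Family metric (↧ₙ ε) I (f ∷ [])) → Covered t G ε
    build (I , f , family) = map (tree-of I) (f ∷ []) , treeCover {↧ₙ ε} {ε = ε} z<s 1≤qε family
      , one-tree (∣ ↥ ε ∣ ^ (12 * t)) ((t * ↧ₙ ε) ^ (12 * t)) (s≤s z≤n)

  wide-cover : ∀ {n t} (G : WGraph (suc n)) → PositiveWeights G → Connected wends G →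
               TreeDecomposition G t → ∀ {ε} → 0ℚ ℚ.< ε → ε ℚ.< 1ℚ → 2 ≤ t → Covered t G ε
  wide-cover {t = t} G pos conn TD {ε} 0<ε ε<1 2≤t
    with ceiling ∣ ↥ ε ∣ (↧ₙ ε) (positive-numerator 0<ε) (proper-fraction 0<ε ε<1)
  ... | K , K>0 , q≤Kp , Kp≤tq = build
    (multiScale-family refl refl refl refl 2≤t K>0 (Decomposed.rooted TD)
      (δ-separates λ i → m≤m*n (16 * K) (w i) {{>-nonZero (w>0 i)}}))
    where
    open Scaling (scaling G pos) using (w; w>0)
    0<16K : 0 < 16 * K
    0<16K = *-pos {16} z<s K>0
    -- The further factor 16K makes every distance between distinct vertices at least `d`, so the
    -- lowest scale φ = 1 is fine enough for the closest pairs.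
    σ = scaleBy (16 * K) 0<16K (scaling G pos)
    open Scaled G σ conn using (metric; scaledDist; δ-separates; module Decomposed)
    open Covering G metric (Scaling.S>0 σ) scaledDist
    build : (∃₂ λ I fs → Family metric K I fs × length fs ≤ 2 ^ ((t * K) ^ 12)) → Covered t G ε
    build (I , fs , family , size) = map (tree-of I) fs
      , treeCover {K} {ε = ε} K>0 (reciprocal-bound {ε} {K} 0<ε q≤Kp) family
      , size-bound {length (map (tree-of I) fs)} {t} {K} 2≤t (<⇒≤ (proper-fraction 0<ε ε<1)) (Kp≤tq t 2≤t)
          (≤-trans (≤-reflexive (length-map (tree-of I) fs)) size)

open import Data.Nat using (_*_; _^_; _≤_; z≤n)
open import Data.Nat.Properties using (≤-<-connex)
open import Data.Integer using (∣_∣)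
open import Data.Fin using (Fin)
open import Data.List using (List; []; length)
open import Data.Product using (Σ; _×_; _,_)
open import Data.Rational using (ℚ; 0ℚ; 1ℚ; _<_; ↥_; ↧ₙ_)
open import Data.Sum using ([_,_]′)
open TreeCovers using (one-tree; narrow-cover; wide-cover)

theorem1p3 : Σ ℕ λ c →
    ∀ (n t : ℕ) (G : WGraph n) → PositiveWeights G → Connected wends G →
    TreewidthAtMost G t →
    (ε : ℚ) → 0ℚ < ε → ε < 1ℚ →
    Σ (List (DominatingTree G)) λ cover → IsTreeCover G ε cover ×
    length cover ^ (∣ ↥ ε ∣ ^ (c * t)) ≤ 2 ^ ((t * ↧ₙ ε) ^ (c * t))
theorem1p3 = 12 , λ where
  zero t G _ _ _ ε _ _ → [] , (λ ()) , one-tree (∣ ↥ ε ∣ ^ (12 * t)) ((t * ↧ₙ ε) ^ (12 * t)) z≤n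
  (suc n) t G pos conn TD ε 0<ε ε<1 → [ narrow-cover G pos conn TD 0<ε , wide-cover G pos conn TD 0<ε ε<1 ]′ (≤-<-connex t 1)
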